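{- For every integer $n\ge 1$, $\overline{p}_3(7n)\equiv (-1)^n r_3(n)\pmod 7$.
   Context: $\overline{p}_3(n)$ denotes the number of overpartition triples of $n$ (triples of overpartitions whose parts together sum to $n$, where an overpartition is a partition in which the first occurrence of each distinct part may be overlined), with $\overline{p}_3(0)=1$; equivalently $\sum_{n\ge0}\overline{p}_3(n)q^n=\big((-q;q)_\infty/(q;q)_\infty\big)^3$, where $(a;q)_\infty=\prod_{n\ge0}(1-aq^n)$. For $k,n\ge0$, $r_k(n)$ denotes the number of representations of $n$ as a sum of $k$ squares, i.e. the number of $(x_1,\dots,x_k)\in\mathbb{Z}^k$ with $x_1^2+\cdots+x_k^2=n$. -}

module Defs where

open import Data.Nat using (ℕ; zero; suc; _+_; _*_; _∸_; _≤ᵇ_)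
open import Data.Integer as ℤ using (ℤ)
open import Data.List using (List; []; _∷_; map; upTo; length; filter; concatMap)
open import Data.Nat.ListAction using (sum)
open import Data.Bool using (if_then_else_)
open import Relation.Binary.PropositionalEquality using (_≡_)
open import Relation.Nullary.Decidable using (does)

-- Overpartitions of n whose parts are all ≤ k, counted by choosing the
-- multiplicity m of the largest allowed part size k.  If m ≥ 1, the first
-- occurrence of k may or may not be overlined (factor 2).
--   op n 0       = [n = 0]
--   op n (k + 1) = op n k + 2 * Σ_{m ≥ 1, m(k+1) ≤ n} op (n - m(k+1)) k
mutual
  op : ℕ → ℕ → ℕ
  op zero    zero    = 1
  op (suc n) zero    = 0
  op n       (suc k) = op n k + 2 * opMult n (suc k) k n

  opMult : ℕ → ℕ → ℕ → ℕ → ℕ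
  opMult n p k zero       = 0
  opMult n p k (suc fuel) =
    (if (suc fuel * p) ≤ᵇ n then op (n ∸ suc fuel * p) k else 0)
    + opMult n p k fuel

overpartitions : ℕ → ℕ
overpartitions n = op n n

p̄₃ : ℕ → ℕ
p̄₃ n = sum (map (λ a → sum (map (λ b →
          overpartitions a * overpartitions b * overpartitions (n ∸ a ∸ b))
          (upTo (suc (n ∸ a))))) (upTo (suc n)))

range : ℕ → List ℤ
range n = map (λ i → ℤ.+ i) (upTo (suc n)) Data.List.++
          map (λ i → ℤ.-[1+ i ]) (upTo n)

-- r₃ n = #{(x,y,z) ∈ ℤ³ : x² + y² + z² = n}; every solution has |x|,|y|,|z| ≤ n.
r₃ : ℕ → ℕ
r₃ n = length (filter (λ t → ℤ._≟_ t (ℤ.+ n))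
  (concatMap (λ x → concatMap (λ y → map (λ z → x ℤ.* x ℤ.+ y ℤ.* y ℤ.+ z ℤ.* z)
     (range n)) (range n)) (range n)))

{-# OPTIONS --safe #-}

-- With P = Σ p̄(n) qⁿ, Gauss' identity reads P · φ(-q) = 1, where φ(q) = Σ_{x ∈ ℤ} q^(x²).
-- Hence P³ = P⁷ φ(-q)⁴ ≡ P(q⁷) φ(-q)⁴ (mod 7), and the exponents divisible by 7 give
-- Σ p̄₃(7n) qⁿ ≡ P · Σ (-1)ⁿ r₄(7n) qⁿ.  As r₄(7n) ≡ r₄(n), this is P φ(-q)⁴ = φ(-q)³.
--
-- For r₄(7n) ≡ r₄(n), take the eight quaternions α = 2 ± i ± j ± k of norm 7.  The map y ↦ αy
-- is a bijection from the integral quaternions of norm n to those of norm 7n that are left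
-- divisible by α, while the number of α dividing a given quaternion of norm 7n is 1 or 8.
--
-- Gauss' identity is proved in the finite form of Shanks, whose induction step is a telescoping
-- sum.

module Submission where

-- Why eight quaternions: modulo 7 the integral quaternions become the 2 × 2 matrices over 𝔽₇, and
-- the norm becomes the determinant. A nonzero singular matrix generates a proper right ideal, and
-- these ideals correspond to the 7 + 1 points of the projective line; each α generates one of them.
-- Left divisibility by α is thus a condition modulo 7, and the counts 1 and 8, like the number of
-- α, are all ≡ 1 (mod 7). Why a finite form of Gauss' identity: in degree n only parts ≤ n and
-- squares x² with |x| ≤ n are visible, so products and sums stay finite, and the error at stage n
-- begins in degree n + 1. Quotients by 1 - q^k are expressed through equations f = h + q^k f, which
-- have only one solution.

open import Algebra.Bundles using (CommutativeRing)
open import Defs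

-- Formal power series over a commutative ring.

module PowerSeries {c ℓ} (R : CommutativeRing c ℓ) where

  open import Data.Nat as ℕ using (ℕ; zero; suc)
  import Data.Nat.Properties as ℕₚ
  open import Data.Product using (_,_)
  open import Relation.Binary using (IsEquivalence)
  open import Relation.Binary.PropositionalEquality as ≡ using (_≢_)
  open import Relation.Nullary using (contradiction)
  import Relation.Binary.Reasoning.Setoid as SetoidReasoning
  import Algebra.Solver.Ring.NaturalCoefficients.Default as SemiringSolver

  private
    module R where
      open CommutativeRing R public
      open import Algebra.Properties.Ring ring public using (-1*x≈-x; -0#≈0#)
      open import Algebra.Properties.Semiring.Exp semiring public using (_^_)

    module RS = SemiringSolver R.commutativeSemiring

  open CommutativeRing R using (Carrier)

  -- Since there is no eta, two series with definitionally equal coefficients can still be different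
  -- terms; the uses of `⊛-congʳ` with `R.refl` below pass between such series.
  record Series : Set c where
    no-eta-equality
    field coeff : ℕ → Carrier

  open Series public

  infix 4 _≋_
  record _≋_ (f g : Series) : Set ℓ where
    constructor pointwise
    field at : ∀ n → coeff f n R.≈ coeff g n

  open _≋_ public

  infixl 6 _⊕_
  infixl 7 _⊛_

  _⊕_ : Series → Series → Series
  coeff (f ⊕ g) n = coeff f n R.+ coeff g n

  ⊖_ : Series → Series
  coeff (⊖ f) n = R.- coeff f n

  𝟘 : Series
  coeff 𝟘 _ = R.0#

  𝟙 : Series
  coeff 𝟙 zero    = R.1#
  coeff 𝟙 (suc _) = R.0#

  X : Series
  coeff X zero    = R.0#
  coeff X (suc n) = coeff 𝟙 n

  tail : Series → Series
  coeff (tail f) n = coeff f (suc n)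

  scale : Carrier → Series → Series
  coeff (scale a f) n = a R.* coeff f n

  -- The Cauchy product, read off from f = f(0) + X · tail f. Each step shifts the left factor, so
  -- inductions on the degree keep that factor general.
  _⊛_ : Series → Series → Series
  coeff (f ⊛ g) zero    = coeff f 0 R.* coeff g 0
  coeff (f ⊛ g) (suc n) = coeff f 0 R.* coeff g (suc n) R.+ coeff (tail f ⊛ g) n

  ≋-isEquivalence : IsEquivalence _≋_
  ≋-isEquivalence = record
    { refl  = pointwise λ n → R.refl
    ; sym   = λ p → pointwise λ n → R.sym (at p n)
    ; trans = λ p q → pointwise λ n → R.trans (at p n) (at q n)
    }

  -- Locality of the product. It later allows φ and P to be replaced by truncations in any fixed
  -- degree.
  ⊛-cong-≤ : ∀ {f f′ g g′} n → (∀ i → i ℕ.≤ n → coeff f i R.≈ coeff f′ i) →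
             (∀ i → i ℕ.≤ n → coeff g i R.≈ coeff g′ i) →
             coeff (f ⊛ g) n R.≈ coeff (f′ ⊛ g′) n
  ⊛-cong-≤ zero    p q = R.*-cong (p 0 ℕ.z≤n) (q 0 ℕ.z≤n)
  ⊛-cong-≤ (suc n) p q = R.+-cong (R.*-cong (p 0 ℕ.z≤n) (q (suc n) ℕₚ.≤-refl))
    (⊛-cong-≤ n (λ i i≤n → p (suc i) (ℕ.s≤s i≤n)) (λ i i≤n → q i (ℕₚ.m≤n⇒m≤1+n i≤n)))

  ⊛-cong : ∀ {f f′ g g′} → f ≋ f′ → g ≋ g′ → f ⊛ g ≋ f′ ⊛ g′
  ⊛-cong p q = pointwise λ n → ⊛-cong-≤ n (λ i _ → at p i) (λ i _ → at q i)

  ⊛-congʳ : ∀ {f f′ g} n → (∀ i → coeff f i R.≈ coeff f′ i) → coeff (f ⊛ g) n R.≈ coeff (f′ ⊛ g) n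
  ⊛-congʳ n p = ⊛-cong-≤ n (λ i _ → p i) (λ _ _ → R.refl)

  ⊛-zeroˡ : ∀ f → 𝟘 ⊛ f ≋ 𝟘
  ⊛-zeroˡ f = pointwise go
    where
    go : ∀ n → coeff (𝟘 ⊛ f) n R.≈ R.0#
    go zero    = R.zeroˡ _
    go (suc n) = R.trans (R.+-cong (R.zeroˡ _) (R.trans (⊛-congʳ {f′ = 𝟘} n (λ _ → R.refl)) (go n))) (R.+-identityˡ _)

  ⊛-identityˡ : ∀ f → 𝟙 ⊛ f ≋ f
  ⊛-identityˡ f = pointwise λ where
    zero    → R.*-identityˡ _
    (suc n) → R.trans
      (R.+-cong (R.*-identityˡ _) (R.trans (⊛-congʳ {f′ = 𝟘} n (λ _ → R.refl)) (at (⊛-zeroˡ f) n)))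
      (R.+-identityʳ _)

  ⊛-distribʳ : ∀ h f g → (f ⊕ g) ⊛ h ≋ f ⊛ h ⊕ g ⊛ h
  ⊛-distribʳ h f g = pointwise λ n → go n f g
    where
    go : ∀ n f g → coeff ((f ⊕ g) ⊛ h) n R.≈ coeff (f ⊛ h) n R.+ coeff (g ⊛ h) n
    go zero    f g = R.distribʳ _ _ _
    go (suc n) f g = R.trans
      (R.+-cong (R.distribʳ _ _ _)
        (R.trans (⊛-congʳ {f′ = tail f ⊕ tail g} n (λ _ → R.refl)) (go n (tail f) (tail g))))
      (RS.solve 4 (λ a b c d → (a RS.:+ b) RS.:+ (c RS.:+ d) RS.:= (a RS.:+ c) RS.:+ (b RS.:+ d)) R.refl _ _ _ _)

  -- The mirror image of the defining recursion, peeling the right factor; comparing the two gives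
  -- commutativity.
  ⊛-suc : ∀ f g n → coeff (f ⊛ g) (suc n) R.≈ coeff (f ⊛ tail g) n R.+ coeff f (suc n) R.* coeff g 0
  ⊛-suc f g zero    = R.refl
  ⊛-suc f g (suc n) = R.trans (R.+-congˡ (⊛-suc (tail f) g n)) (R.sym (R.+-assoc _ _ _))

  ⊛-comm : ∀ f g → f ⊛ g ≋ g ⊛ f
  ⊛-comm f g = pointwise λ n → go n f g
    where
    go : ∀ n f g → coeff (f ⊛ g) n R.≈ coeff (g ⊛ f) n
    go zero    f g = R.*-comm _ _
    go (suc n) f g = R.trans (R.+-cong (R.*-comm _ _) (go n (tail f) g))
      (R.trans (R.+-comm _ _) (R.sym (⊛-suc g f n)))

  scale-⊛ : ∀ a f g → scale a f ⊛ g ≋ scale a (f ⊛ g)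
  scale-⊛ a f g = pointwise λ n → go n f
    where
    go : ∀ n f → coeff (scale a f ⊛ g) n R.≈ a R.* coeff (f ⊛ g) n
    go zero    f = R.*-assoc _ _ _
    go (suc n) f = R.trans
      (R.+-cong (R.*-assoc _ _ _)
        (R.trans (⊛-congʳ {f′ = scale a (tail f)} n (λ _ → R.refl)) (go n (tail f))))
      (R.sym (R.distribˡ _ _ _))

  ⊛-assoc : ∀ f g h → (f ⊛ g) ⊛ h ≋ f ⊛ (g ⊛ h)
  ⊛-assoc f g h = pointwise λ n → go n f
    where
    open SetoidReasoning R.setoid
    go : ∀ n f → coeff ((f ⊛ g) ⊛ h) n R.≈ coeff (f ⊛ (g ⊛ h)) n
    go zero    f = R.*-assoc _ _ _
    go (suc n) f = begin
      a R.* b R.* coeff h (suc n) R.+ coeff (tail (f ⊛ g) ⊛ h) n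
        ≈⟨ R.+-congˡ (⊛-congʳ {f′ = scale a (tail g) ⊕ tail f ⊛ g} n (λ _ → R.refl)) ⟩
      a R.* b R.* coeff h (suc n) R.+ coeff ((scale a (tail g) ⊕ tail f ⊛ g) ⊛ h) n
        ≈⟨ R.+-congˡ (at (⊛-distribʳ h _ _) n) ⟩
      a R.* b R.* coeff h (suc n) R.+ (coeff (scale a (tail g) ⊛ h) n R.+ coeff ((tail f ⊛ g) ⊛ h) n)
        ≈⟨ R.+-congˡ (R.+-cong (at (scale-⊛ a (tail g) h) n) (go n (tail f))) ⟩
      a R.* b R.* coeff h (suc n) R.+ (a R.* coeff (tail g ⊛ h) n R.+ coeff (tail f ⊛ (g ⊛ h)) n)
        ≈⟨ RS.solve 5 (λ a b x y z →
             a RS.:* b RS.:* x RS.:+ (a RS.:* y RS.:+ z) RS.:= a RS.:* (b RS.:* x RS.:+ y) RS.:+ z)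
             R.refl _ _ _ _ _ ⟩
      coeff (f ⊛ (g ⊛ h)) (suc n) ∎
      where
      a = coeff f 0
      b = coeff g 0

  seriesRing : CommutativeRing c ℓ
  seriesRing = record
    { Carrier = Series ; _≈_ = _≋_ ; _+_ = _⊕_ ; _*_ = _⊛_ ; -_ = ⊖_ ; 0# = 𝟘 ; 1# = 𝟙
    ; isCommutativeRing = record
      { isRing = record
        { +-isAbelianGroup = record
          { isGroup = record
            { isMonoid = record
              { isSemigroup = record
                { isMagma = record
                  { isEquivalence = ≋-isEquivalence
                  ; ∙-cong = λ p q → pointwise λ n → R.+-cong (at p n) (at q n)
                  }
                ; assoc = λ _ _ _ → pointwise λ n → R.+-assoc _ _ _
                }
              ; identity = (λ _ → pointwise λ n → R.+-identityˡ _) , (λ _ → pointwise λ n → R.+-identityʳ _)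
              }
            ; inverse = (λ _ → pointwise λ n → R.-‿inverseˡ _) , (λ _ → pointwise λ n → R.-‿inverseʳ _)
            ; ⁻¹-cong = λ p → pointwise λ n → R.-‿cong (at p n)
            }
          ; comm = λ _ _ → pointwise λ n → R.+-comm _ _
          }
        ; *-cong = ⊛-cong
        ; *-assoc = ⊛-assoc
        ; *-identity = ⊛-identityˡ , λ f → S.trans (⊛-comm f 𝟙) (⊛-identityˡ f)
        ; distrib = (λ f g h → S.trans (⊛-comm f (g ⊕ h)) (S.trans (⊛-distribʳ f g h)
                      (pointwise λ n → R.+-cong (at (⊛-comm g f) n) (at (⊛-comm h f) n))))
                  , ⊛-distribʳ
        }
      ; *-comm = ⊛-comm
      }
    }
    where module S = IsEquivalence ≋-isEquivalence

  X⊛-zero : ∀ f → coeff (X ⊛ f) 0 R.≈ R.0#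
  X⊛-zero f = R.zeroˡ _

  X⊛-suc : ∀ f n → coeff (X ⊛ f) (suc n) R.≈ coeff f n
  X⊛-suc f n = R.trans (R.+-cong (R.zeroˡ _)
    (R.trans (⊛-congʳ {f′ = 𝟙} n (λ _ → R.refl)) (at (⊛-identityˡ f) n))) (R.+-identityˡ _)

  open CommutativeRing seriesRing using (ring; semiring)
  open import Algebra.Properties.Ring ring using (-‿distribˡ-*)
  open import Algebra.Properties.Semiring.Exp semiring public using (_^_)

  X^-⊛-< : ∀ k f m → m ℕ.< k → coeff (X ^ k ⊛ f) m R.≈ R.0#
  X^-⊛-< (suc k) f zero    _           = R.trans (at (⊛-assoc X (X ^ k) f) 0) (X⊛-zero (X ^ k ⊛ f))
  X^-⊛-< (suc k) f (suc m) (ℕ.s≤s m<k) = R.trans (at (⊛-assoc X (X ^ k) f) (suc m))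
    (R.trans (X⊛-suc (X ^ k ⊛ f) m) (X^-⊛-< k f m m<k))

  X^-⊛-+ : ∀ k f m → coeff (X ^ k ⊛ f) (k ℕ.+ m) R.≈ coeff f m
  X^-⊛-+ zero    f m = at (⊛-identityˡ f) m
  X^-⊛-+ (suc k) f m = R.trans (at (⊛-assoc X (X ^ k) f) (suc k ℕ.+ m))
    (R.trans (X⊛-suc (X ^ k ⊛ f) (k ℕ.+ m)) (X^-⊛-+ k f m))

  coeff-[⊖X]^-≡ : ∀ k → coeff ((⊖ X) ^ k) k R.≈ (R.- R.1#) R.^ k
  coeff-[⊖X]^-≡ zero    = R.refl
  coeff-[⊖X]^-≡ (suc k) = R.trans (R.sym (at (-‿distribˡ-* X ((⊖ X) ^ k)) (suc k)))
    (R.trans (R.-‿cong (X⊛-suc ((⊖ X) ^ k) k))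
    (R.trans (R.sym (R.-1*x≈-x _)) (R.*-congˡ (coeff-[⊖X]^-≡ k))))

  coeff-[⊖X]^-≢ : ∀ k m → k ≢ m → coeff ((⊖ X) ^ k) m R.≈ R.0#
  coeff-[⊖X]^-≢ zero    zero    k≢m = contradiction ≡.refl k≢m
  coeff-[⊖X]^-≢ zero    (suc m) k≢m = R.refl
  coeff-[⊖X]^-≢ (suc k) zero    k≢m = R.trans (R.sym (at (-‿distribˡ-* X ((⊖ X) ^ k)) 0))
    (R.trans (R.-‿cong (X⊛-zero ((⊖ X) ^ k))) R.-0#≈0#)
  coeff-[⊖X]^-≢ (suc k) (suc m) k≢m = R.trans (R.sym (at (-‿distribˡ-* X ((⊖ X) ^ k)) (suc m)))
    (R.trans (R.-‿cong (R.trans (X⊛-suc ((⊖ X) ^ k) m) (coeff-[⊖X]^-≢ k m λ { ≡.refl → k≢m ≡.refl }))) R.-0#≈0#)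

-- Gauss' identity in Shanks' finite form.

module GaussIdentity {c ℓ} (R : CommutativeRing c ℓ) where

  open import Data.Nat as ℕ using (ℕ; zero; suc)
  import Data.Nat.Properties as ℕₚ
  open import Data.Product using (_,_)
  open import Relation.Binary.PropositionalEquality as ≡ using ()
  open import Relation.Nullary using (yes; no)
  import Algebra.Solver.Ring.NaturalCoefficients.Default as SemiringSolver

  private module R = CommutativeRing R
  open PowerSeries R
  open CommutativeRing seriesRing
  open import Algebra.Properties.Ring ring using (-‿distribˡ-*; -1*x≈-x)
  open import Algebra.Properties.CommutativeSemiring.Exp commutativeSemiring using (^-homo-*; ^-assocʳ; ^-distrib-*; ^-congˡ)
  open import Relation.Binary.Reasoning.Setoid setoid
  open SemiringSolver commutativeSemiring using (solve; _:+_; _:*_; _:=_; con)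

  -- The solver treats commutative semirings, so -1 enters its identities as an indeterminate. Its
  -- defining relation is used by adding or deleting a multiple of `1# + ε`, which is zero.
  ε : Series
  ε = - 1#

  1+ε : 1# + ε ≈ 0#
  1+ε = -‿inverseʳ 1#

  ε^n*n : ∀ n → ε ^ (n ℕ.* n) ≈ ε ^ n
  ε^n*n zero    = refl
  ε^n*n (suc n) = begin
    ε ^ (suc n ℕ.* suc n)          ≡⟨ ≡.cong (λ k → ε ^ suc (n ℕ.+ k)) (ℕₚ.*-suc n n) ⟩
    ε * ε ^ (n ℕ.+ (n ℕ.+ n ℕ.* n)) ≈⟨ *-congˡ (trans (^-homo-* ε n _) (*-congˡ (^-homo-* ε n _))) ⟩
    ε * (ε ^ n * (ε ^ n * ε ^ (n ℕ.* n))) ≈⟨ *-congˡ (*-congˡ (*-congˡ (ε^n*n n))) ⟩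
    ε * (ε ^ n * (ε ^ n * ε ^ n))
      ≈⟨ solve 2 (λ e x → e :* (x :* (x :* x)) := (x :* x) :* (e :* x)) refl ε (ε ^ n) ⟩
    (ε ^ n * ε ^ n) * (ε * ε ^ n) ≈⟨ *-congʳ (square n) ⟩
    1# * (ε * ε ^ n)              ≈⟨ *-identityˡ _ ⟩
    ε ^ suc n ∎
    where
    ε*ε : ε * ε ≈ 1#
    ε*ε = begin
      ε * ε ≈⟨ sym (+-identityˡ _) ⟩
      0# + ε * ε ≈⟨ +-congʳ (sym 1+ε) ⟩
      (1# + ε) + ε * ε ≈⟨ solve 1 (λ e → (con 1 :+ e) :+ e :* e := con 1 :+ (con 1 :+ e) :* e) refl ε ⟩
      1# + (1# + ε) * ε ≈⟨ +-congˡ (trans (*-congʳ 1+ε) (zeroˡ ε)) ⟩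
      1# + 0# ≈⟨ +-identityʳ 1# ⟩
      1# ∎
    square : ∀ n → ε ^ n * ε ^ n ≈ 1#
    square n = trans (sym (^-distrib-* ε ε n)) (trans (^-congˡ n ε*ε) (1^n n))
      where
      1^n : ∀ n → 1# ^ n ≈ 1#
      1^n zero    = refl
      1^n (suc n) = trans (*-identityˡ _) (1^n n)

  -- As n² and n have the same parity, a theta term becomes εⁿ yⁿ at y = Xⁿ, the shape of the factor
  -- in a summand of `shanks`.
  [-X]^n*n : ∀ n → (- X) ^ (n ℕ.* n) ≈ ε ^ n * (X ^ n) ^ n
  [-X]^n*n n = begin
    (- X) ^ (n ℕ.* n)                   ≈⟨ ^-congˡ (n ℕ.* n) (sym (-1*x≈-x X)) ⟩
    (ε * X) ^ (n ℕ.* n)                 ≈⟨ ^-distrib-* ε X (n ℕ.* n) ⟩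
    ε ^ (n ℕ.* n) * X ^ (n ℕ.* n)       ≈⟨ *-cong (ε^n*n n) (sym (^-assocʳ X n n)) ⟩
    ε ^ n * (X ^ n) ^ n ∎

  -- Stands in for division by 1 - X^(k+1): the equation expresses each coefficient through lower
  -- ones. In `go`, `m` is the bound of a strong induction on n.
  X^-cancel : ∀ k f g h → f ≈ h + X ^ suc k * f → g ≈ h + X ^ suc k * g → f ≈ g
  X^-cancel k f g h p q = pointwise λ n → go n n ℕₚ.≤-refl
    where
    step : ∀ n → coeff (X ^ suc k * f) n R.≈ coeff (X ^ suc k * g) n → coeff f n R.≈ coeff g n
    step n eq = R.trans (at p n) (R.trans (R.+-congˡ eq) (R.sym (at q n)))
    go : ∀ m n → n ℕ.≤ m → coeff f n R.≈ coeff g n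
    go m n n≤m with n ℕ.<? suc k
    ... | yes n<k = step n (R.trans (X^-⊛-< (suc k) f n n<k) (R.sym (X^-⊛-< (suc k) g n n<k)))
    ... | no  n≮k with ℕₚ.m≤n⇒∃[o]m+o≡n (ℕₚ.≮⇒≥ n≮k)
    go zero    .(suc (k ℕ.+ j)) () | no _ | j , ≡.refl
    go (suc m) .(suc (k ℕ.+ j)) (ℕ.s≤s k+j≤m) | no _ | j , ≡.refl = step (suc (k ℕ.+ j))
      (R.trans (X^-⊛-+ (suc k) f j)
      (R.trans (go m j (ℕₚ.≤-trans (ℕₚ.m≤n+m j k) k+j≤m)) (R.sym (X^-⊛-+ (suc k) g j))))

  -- The recurrence is (1 - X^(k+1)) O(k+1) = (1 + X^(k+1)) O(k) without subtraction, so O k is the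
  -- product of (1 + X^i) / (1 - X^i) over 1 ≤ i ≤ k.
  module _ (O : ℕ → Series) (O-zero : O 0 ≈ 1#)
           (O-suc : ∀ k → O (suc k) ≈ O k + X ^ suc k * (O k + O (suc k))) where

    -- At w = qⁿ⁺¹ and t = n, this is Shanks' expansion of the n-th partial sum of φ(-q),
    -- multiplied by O n.
    shanks : Series → ℕ → Series
    shanks w zero    = 1#
    shanks w (suc t) = shanks w t + ε ^ suc t * w ^ suc t * (O t + O (suc t))

    -- A q-difference equation: with F(y) = `shanks y t` it reads (1 - y) F(Xy) = (1 + y) F(y) + 2
    -- (-1)^(t+1) y^(t+1) O(t). The last term is the boundary term that telescoping over t leaves
    -- behind.
    shanks-X* : ∀ y t → shanks (X * y) t ≈
      shanks y t + y * (shanks y t + shanks (X * y) t) + (1# + 1#) * (ε ^ suc t * y ^ suc t * O t)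
    shanks-X* y zero = sym (begin
      1# + y * (1# + 1#) + (1# + 1#) * (ε * 1# * (y * 1#) * O 0) ≈⟨ +-congˡ (*-congˡ (*-congˡ O-zero)) ⟩
      1# + y * (1# + 1#) + (1# + 1#) * (ε * 1# * (y * 1#) * 1#)
        ≈⟨ solve 2 (λ y e →
              con 1 :+ y :* con 2 :+ con 2 :* (e :* con 1 :* (y :* con 1) :* con 1)
           := con 1 :+ (con 1 :+ e) :* (con 2 :* y)) refl y ε ⟩
      1# + (1# + ε) * ((1# + 1#) * y) ≈⟨ +-congˡ (trans (*-congʳ 1+ε) (zeroˡ _)) ⟩
      1# + 0# ≈⟨ +-identityʳ 1# ⟩
      1# ∎)
    shanks-X* y (suc t) = begin
      A′ + ε ^ suc t * (X * y) ^ suc t * (o + p)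
        ≈⟨ +-congˡ (*-congʳ (*-congˡ (^-distrib-* X y (suc t)))) ⟩
      A′ + ε ^ suc t * (x * y ^ suc t) * (o + p)
        ≈⟨ solve 5 (λ a e x y s → a :+ e :* (x :* y) :* s := a :+ e :* y :* (x :* s)) refl A′ (ε ^ suc t) x (y ^ suc t) (o + p) ⟩
      A′ + u * v ≈⟨ +-congʳ (shanks-X* y t) ⟩
      A + y * (A + A′) + (1# + 1#) * (u * o) + u * v
        -- Here `o + v` is `O (suc t)` by the recurrence. Of the added zero, the multiple of ε is
        -- the boundary term of index t + 1, and the other half completes y times the new summands.
        ≈⟨ sym (trans (+-congˡ (trans (*-congʳ 1+ε) (zeroˡ _))) (+-identityʳ _)) ⟩
      A + y * (A + A′) + (1# + 1#) * (u * o) + u * v + (1# + ε) * ((1# + 1#) * (y * (u * (o + v))))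
        ≈⟨ solve 7 (λ a a′ y u o v e →
              a :+ y :* (a :+ a′) :+ con 2 :* (u :* o) :+ u :* v :+ (con 1 :+ e) :* (con 2 :* (y :* (u :* (o :+ v))))
           := a :+ u :* (o :+ (o :+ v)) :+ y :* (a :+ u :* (o :+ (o :+ v)) :+ (a′ :+ u :* v))
              :+ con 2 :* (e :* u :* y :* (o :+ v))) refl A A′ y u o v ε ⟩
      A + u * (o + (o + v)) + y * (A + u * (o + (o + v)) + (A′ + u * v)) + (1# + 1#) * (ε * u * y * (o + v))
        ≈⟨ +-cong (+-cong (+-congˡ (*-congˡ (+-congˡ (sym (O-suc t)))))
                          (*-congˡ (+-cong (+-congˡ (*-congˡ (+-congˡ (sym (O-suc t))))) (+-congˡ (*-congˡ refl)))))
                  (*-congˡ (*-congˡ (sym (O-suc t)))) ⟩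
      A + u * (o + p) + y * (A + u * (o + p) + (A′ + u * v)) + (1# + 1#) * (ε * u * y * p)
        ≈⟨ solve 9 (λ a y o p a′ e y′ x e′ →
              a :+ e :* y′ :* (o :+ p)
              :+ y :* (a :+ e :* y′ :* (o :+ p) :+ (a′ :+ e :* y′ :* (x :* (o :+ p))))
              :+ con 2 :* (e′ :* (e :* y′) :* y :* p)
           := a :+ e :* y′ :* (o :+ p)
              :+ y :* (a :+ e :* y′ :* (o :+ p) :+ (a′ :+ e :* (x :* y′) :* (o :+ p)))
              :+ con 2 :* (e′ :* e :* (y :* y′) :* p))
             refl A y o p A′ (ε ^ suc t) (y ^ suc t) x ε ⟩
      A + u * (o + p) + y * (A + u * (o + p) + (A′ + ε ^ suc t * (x * y ^ suc t) * (o + p)))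
        + (1# + 1#) * (ε ^ suc (suc t) * y ^ suc (suc t) * p)
        ≈⟨ +-congʳ (+-congˡ (*-congˡ (+-congˡ (+-congˡ (*-congʳ (*-congˡ (sym (^-distrib-* X y (suc t))))))))) ⟩
      A + u * (o + p) + y * (A + u * (o + p) + (A′ + ε ^ suc t * (X * y) ^ suc t * (o + p)))
        + (1# + 1#) * (ε ^ suc (suc t) * y ^ suc (suc t) * p) ∎
      where
      A = shanks y t
      A′ = shanks (X * y) t
      o = O t
      p = O (suc t)
      x = X ^ suc t
      u = ε ^ suc t * y ^ suc t
      v = x * (o + p)

    module _ (S : ℕ → Series) (S-zero : S 0 ≈ 1#)
             (S-suc : ∀ k → S (suc k) ≈ S k + ((- X) ^ (suc k ℕ.* suc k) + (- X) ^ (suc k ℕ.* suc k))) where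

      -- With y = X^(n+1), both sides at n + 1 solve f = h + y f. For `shanks` this is the
      -- q-difference equation; for S · O it comes from multiplying the recurrence of O by S n and
      -- inserting the induction hypothesis. The two match because the factor `w` of the last
      -- summand of `shanks y (suc n)` is exactly the theta term (-X)^((n+1)²).
      S*O≈shanks : ∀ n → S n * O n ≈ shanks (X ^ suc n) n
      S*O≈shanks zero    = trans (*-cong S-zero O-zero) (*-identityˡ _)
      S*O≈shanks (suc n) = X^-cancel n (S (suc n) * O (suc n)) (shanks (X * y) (suc n)) h SO-eq shanks-eq
        where
        y = X ^ suc n
        o = O n
        p = O (suc n)
        w = ε ^ suc n * y ^ suc n
        B = shanks y (suc n)
        h = B + y * B + (1# + 1#) * (ε * w * y * p)
        s = S n

        shanks-eq : shanks (X * y) (suc n) ≈ h + y * shanks (X * y) (suc n)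
        shanks-eq = trans (shanks-X* y (suc n))
          (solve 7 (λ b y f e e′ y′ p →
             b :+ y :* (b :+ f) :+ con 2 :* (e :* e′ :* (y :* y′) :* p)
          := b :+ y :* b :+ con 2 :* (e :* (e′ :* y′) :* y :* p) :+ y :* f)
            refl B y (shanks (X * y) (suc n)) ε (ε ^ suc n) (y ^ suc n) p)

        s*p : s * p ≈ shanks y n + y * (shanks y n + s * p)
        s*p = begin
          s * p ≈⟨ *-congˡ (O-suc n) ⟩
          s * (o + y * (o + p))
            ≈⟨ solve 4 (λ s o y p → s :* (o :+ y :* (o :+ p)) := s :* o :+ y :* (s :* o :+ s :* p)) refl s o y p ⟩
          s * o + y * (s * o + s * p) ≈⟨ +-cong (S*O≈shanks n) (*-congˡ (+-congʳ (S*O≈shanks n))) ⟩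
          shanks y n + y * (shanks y n + s * p) ∎

        S-step : S (suc n) ≈ s + (w + w)
        S-step = trans (S-suc n) (+-congˡ (+-cong ([-X]^n*n (suc n)) ([-X]^n*n (suc n))))

        SO-eq : S (suc n) * p ≈ h + y * (S (suc n) * p)
        SO-eq = begin
          S (suc n) * p ≈⟨ *-congʳ S-step ⟩
          (s + (w + w)) * p
            ≈⟨ solve 3 (λ s w p → (s :+ (w :+ w)) :* p := s :* p :+ (w :* p :+ w :* p)) refl s w p ⟩
          s * p + (w * p + w * p) ≈⟨ +-cong s*p (+-congʳ (*-congˡ (O-suc n))) ⟩
          (a + y * (a + s * p)) + (w * (o + y * (o + p)) + w * p)
            ≈⟨ sym (trans (+-congˡ (trans (*-congʳ 1+ε) (zeroˡ _))) (+-identityʳ _)) ⟩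
          (a + y * (a + s * p)) + (w * (o + y * (o + p)) + w * p) + (1# + ε) * ((1# + 1#) * (w * y * p))
            ≈⟨ solve 7 (λ a y s p o w e →
                 (a :+ y :* (a :+ s :* p)) :+ (w :* (o :+ y :* (o :+ p)) :+ w :* p) :+ (con 1 :+ e) :* (con 2 :* (w :* y :* p))
              := (a :+ w :* (o :+ p)) :+ y :* (a :+ w :* (o :+ p)) :+ con 2 :* (e :* w :* y :* p) :+ y :* ((s :+ (w :+ w)) :* p))
                 refl a y s p o w ε ⟩
          h + y * ((s + (w + w)) * p) ≈⟨ +-congˡ (*-congˡ (*-congʳ (sym S-step))) ⟩
          h + y * (S (suc n) * p) ∎
          where a = shanks y n

      -- At w = X^(n+1), every summand of `shanks` after the leading 1 is divisible by X^(n+1),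
      -- hence invisible in degrees ≤ n.
      gauss : ∀ n m → m ℕ.≤ n → coeff (S n * O n) m R.≈ coeff 1# m
      gauss n m m≤n = R.trans (at (S*O≈shanks n) m) (go n)
        where
        go : ∀ t → coeff (shanks (X ^ suc n) t) m R.≈ coeff 1# m
        go zero    = R.refl
        go (suc t) = R.trans (R.+-cong (go t) (R.trans
            (at (solve 4 (λ a b c d → a :* (b :* c) :* d := b :* (a :* c :* d)) refl
                  (ε ^ suc t) (X ^ suc n) ((X ^ suc n) ^ t) (O t + O (suc t))) m)
            (X^-⊛-< (suc n) _ m (ℕ.s≤s m≤n))))
          (R.+-identityʳ _)

-- Seventh powers in characteristic 7 and the extraction of exponents divisible by 7.

module Frobenius {c ℓ} (R : CommutativeRing c ℓ) where

  open import Data.Nat as ℕ using (ℕ; zero; suc)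
  import Data.Nat.Properties as ℕₚ
  open import Relation.Binary.PropositionalEquality as ≡ using ()
  import Relation.Binary.Reasoning.Setoid as SetoidReasoning
  import Algebra.Solver.Ring.NaturalCoefficients.Default as SemiringSolver
  import Algebra.Properties.CommutativeSemiring.Exp as Exp

  private
    module R where
      open CommutativeRing R public
      open Exp commutativeSemiring public using (_^_)
  open PowerSeries R
  open CommutativeRing seriesRing
  open Exp commutativeSemiring using (^-distrib-*; ^-congˡ)
  open SemiringSolver commutativeSemiring using (solve; _:+_; _:*_; _:^_; _:=_; con)

  constant : R.Carrier → Series
  constant a = scale a 𝟙

  coeff-constant-* : ∀ a f n → coeff (constant a * f) n R.≈ a R.* coeff f n
  coeff-constant-* a f n = R.trans (at (scale-⊛ a 𝟙 f) n) (R.*-congˡ (at (*-identityˡ f) n))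

  constant-^ : ∀ a k → constant a ^ k ≈ constant (a R.^ k)
  constant-^ a zero    = pointwise λ n → R.sym (R.*-identityˡ _)
  constant-^ a (suc k) = trans (*-congˡ (constant-^ a k)) (pointwise λ n →
    R.trans (coeff-constant-* a _ n) (R.sym (R.*-assoc _ _ _)))

  head+X*tail : ∀ f → f ≈ constant (coeff f 0) + X * tail f
  head+X*tail f = pointwise λ where
    zero    → R.sym (R.trans (R.+-cong (R.*-identityʳ _) (X⊛-zero (tail f))) (R.+-identityʳ _))
    (suc n) → R.sym (R.trans (R.+-cong (R.zeroʳ _) (X⊛-suc (tail f) n)) (R.+-identityˡ _))

  multisect : ℕ → Series → Series
  coeff (multisect p f) n = coeff f (p ℕ.* n)

  module _ (char : (R.1# R.+ R.1# R.+ R.1# R.+ R.1# R.+ R.1# R.+ R.1# R.+ R.1#) R.≈ R.0#)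
           (fermat : ∀ a → a R.^ 7 R.≈ a) where

    -- The left-nested sum that `con 7` denotes in the solver.
    seven : Series
    seven = 1# + 1# + 1# + 1# + 1# + 1# + 1#

    seven≈0 : seven ≈ 0#
    seven≈0 = pointwise λ where
      zero    → char
      (suc n) → R.trans (R.+-congʳ (R.trans (R.+-congʳ (R.trans (R.+-congʳ (R.trans (R.+-congʳ (R.trans (R.+-congʳ
                  (R.+-identityˡ _)) (R.+-identityˡ _))) (R.+-identityˡ _))) (R.+-identityˡ _))) (R.+-identityˡ _))) (R.+-identityˡ _)

    -- The inner binomial coefficients 7, 21, 35, 35, 21, 7 are 7 times 1, 3, 5, 5, 3, 1.
    [f+g]^7 : ∀ f g → (f + g) ^ 7 ≈ f ^ 7 + g ^ 7
    [f+g]^7 f g = trans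
      (solve 2 (λ f g → (f :+ g) :^ 7 := f :^ 7 :+ g :^ 7 :+
          con 7 :* (f :* g :* (f :^ 5 :+ con 3 :* f :^ 4 :* g :+ con 5 :* f :^ 3 :* g :^ 2
                    :+ con 5 :* f :^ 2 :* g :^ 3 :+ con 3 :* f :* g :^ 4 :+ g :^ 5)))
        refl f g)
      (trans (+-congˡ (trans (*-congʳ seven≈0) (zeroˡ _))) (+-identityʳ _))

    -- The reason is f⁷ = f(X⁷). The substitution is never formed: splitting off the constant term
    -- gives f⁷ = f(0) + X⁷ (tail f)⁷ by Frobenius and Fermat, and a shift by 7 before multisection
    -- is a shift by 1 after it, which is the recursion of `_⊛_`.
    multisect-^7-* : ∀ f g → multisect 7 (f ^ 7 * g) ≈ f * multisect 7 g
    multisect-^7-* f g = pointwise λ n → go n f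
      where
      open SetoidReasoning R.setoid

      expand : ∀ f → f ^ 7 * g ≈ constant (coeff f 0) * g + X ^ 7 * (tail f ^ 7 * g)
      expand f = trans (*-congʳ (trans (^-congˡ 7 (head+X*tail f)) (trans ([f+g]^7 _ _)
          (+-cong (trans (constant-^ _ 7) (pointwise λ n → R.*-congʳ (fermat _))) (^-distrib-* X (tail f) 7)))))
        (trans (distribʳ g _ _) (+-congˡ (*-assoc _ _ _)))

      go : ∀ n f → coeff (f ^ 7 * g) (7 ℕ.* n) R.≈ coeff (f * multisect 7 g) n
      go zero f = begin
        coeff (f ^ 7 * g) 0 ≈⟨ at (expand f) 0 ⟩
        coeff (constant (coeff f 0) * g) 0 R.+ coeff (X ^ 7 * (tail f ^ 7 * g)) 0
          ≈⟨ R.+-cong (coeff-constant-* _ g 0) (X^-⊛-< 7 (tail f ^ 7 * g) 0 (ℕ.s≤s ℕ.z≤n)) ⟩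
        coeff f 0 R.* coeff g 0 R.+ R.0# ≈⟨ R.+-identityʳ _ ⟩
        coeff f 0 R.* coeff g 0 ∎
      go (suc n) f = begin
        coeff (f ^ 7 * g) (7 ℕ.* suc n) ≈⟨ at (expand f) (7 ℕ.* suc n) ⟩
        coeff (constant (coeff f 0) * g) (7 ℕ.* suc n) R.+ coeff (X ^ 7 * (tail f ^ 7 * g)) (7 ℕ.* suc n)
          ≈⟨ R.+-cong (coeff-constant-* _ g (7 ℕ.* suc n)) (R.reflexive (≡.cong (coeff (X ^ 7 * (tail f ^ 7 * g))) (ℕₚ.*-suc 7 n))) ⟩
        coeff f 0 R.* coeff g (7 ℕ.* suc n) R.+ coeff (X ^ 7 * (tail f ^ 7 * g)) (7 ℕ.+ 7 ℕ.* n)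
          ≈⟨ R.+-congˡ (R.trans (X^-⊛-+ 7 (tail f ^ 7 * g) (7 ℕ.* n)) (go n (tail f))) ⟩
        coeff f 0 R.* coeff g (7 ℕ.* suc n) R.+ coeff (tail f * multisect 7 g) n ∎

-- Finite sums indexed by lists.

module ListSum {c ℓ} (R : CommutativeRing c ℓ) where

  open import Data.List using (List; []; _∷_; _++_; map; concatMap; cartesianProduct)
  open import Data.Product using (_,_)
  open import Function using (_∘_)

  open CommutativeRing R

  ∑ : ∀ {A : Set} → List A → (A → Carrier) → Carrier
  ∑ []       f = 0#
  ∑ (x ∷ xs) f = f x + ∑ xs f

  module _ {A : Set} where

    ∑-cong : ∀ (xs : List A) {f g : A → Carrier} → (∀ x → f x ≈ g x) → ∑ xs f ≈ ∑ xs g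
    ∑-cong []       p = refl
    ∑-cong (x ∷ xs) p = +-cong (p x) (∑-cong xs p)

    ∑-++ : ∀ (xs ys : List A) (f : A → Carrier) → ∑ (xs ++ ys) f ≈ ∑ xs f + ∑ ys f
    ∑-++ []       ys f = sym (+-identityˡ _)
    ∑-++ (x ∷ xs) ys f = trans (+-congˡ (∑-++ xs ys f)) (sym (+-assoc _ _ _))

    ∑-*ʳ : ∀ (xs : List A) (f : A → Carrier) a → ∑ xs f * a ≈ ∑ xs (λ x → f x * a)
    ∑-*ʳ []       f a = zeroˡ a
    ∑-*ʳ (x ∷ xs) f a = trans (distribʳ a _ _) (+-congˡ (∑-*ʳ xs f a))

    ∑-*ˡ : ∀ (xs : List A) (f : A → Carrier) a → a * ∑ xs f ≈ ∑ xs (λ x → a * f x)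
    ∑-*ˡ []       f a = zeroʳ a
    ∑-*ˡ (x ∷ xs) f a = trans (distribˡ a _ _) (+-congˡ (∑-*ˡ xs f a))

  module _ {A B : Set} where

    ∑-map : ∀ (g : A → B) xs (f : B → Carrier) → ∑ (map g xs) f ≈ ∑ xs (f ∘ g)
    ∑-map g []       f = refl
    ∑-map g (x ∷ xs) f = +-congˡ (∑-map g xs f)

    ∑-concatMap : ∀ (g : A → List B) xs (f : B → Carrier) → ∑ (concatMap g xs) f ≈ ∑ xs (λ x → ∑ (g x) f)
    ∑-concatMap g []       f = refl
    ∑-concatMap g (x ∷ xs) f = trans (∑-++ (g x) _ f) (+-congˡ (∑-concatMap g xs f))

  module _ {A B : Set} where

    ∑-cartesianProduct : ∀ (xs : List A) (ys : List B) (f : A → Carrier) (g : B → Carrier) →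
      ∑ (cartesianProduct xs ys) (λ (x , y) → f x * g y) ≈ ∑ xs f * ∑ ys g
    ∑-cartesianProduct []       ys f g = sym (zeroˡ _)
    ∑-cartesianProduct (x ∷ xs) ys f g = trans (∑-++ (map (x ,_) ys) (cartesianProduct xs ys) _)
      (trans (+-cong (trans (∑-map (x ,_) ys _) (sym (∑-*ˡ ys g (f x)))) (∑-cartesianProduct xs ys f g))
        (sym (distribʳ _ _ _)))

-- Recurrences for overpartitions with bounded parts.

module Overpartitions where

  open import Data.Bool using (true; false; T; if_then_else_)
  open import Data.Nat
  import Data.Nat.Properties as ℕₚ
  open import Algebra.Properties.CommutativeSemigroup ℕₚ.+-commutativeSemigroup using (x∙yz≈y∙xz)
  open import Data.Nat.Solver using (module +-*-Solver)
  open import Data.Unit using (tt)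
  open import Relation.Nullary using (contradiction)
  open import Relation.Binary.PropositionalEquality as ≡ using (_≡_)

  op-suc : ∀ n k → op n (suc k) ≡ op n k + 2 * opMult n (suc k) k n
  op-suc zero    k = ≡.refl
  op-suc (suc n) k = ≡.refl

  term : ℕ → ℕ → ℕ → ℕ
  term a n k = if a ≤ᵇ n then op (n ∸ a) k else 0

  term-> : ∀ {a n} k → n < a → term a n k ≡ 0
  term-> {a} {n} k n<a with a ≤ᵇ n in eq
  ... | false = ≡.refl
  ... | true  = contradiction (ℕₚ.≤ᵇ⇒≤ a n (≡.subst T (≡.sym eq) tt)) (ℕₚ.<⇒≱ n<a)

  +-≤ᵇ-+ : ∀ p a n → (p + a ≤ᵇ p + n) ≡ (a ≤ᵇ n)
  +-≤ᵇ-+ zero    a n = ≡.refl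
  +-≤ᵇ-+ (suc p) a n = ≡.trans (<ᵇ-suc (p + a) (p + n)) (+-≤ᵇ-+ p a n)
    where
    <ᵇ-suc : ∀ m n → (m <ᵇ suc n) ≡ (m ≤ᵇ n)
    <ᵇ-suc zero    n = ≡.refl
    <ᵇ-suc (suc m) n = ≡.refl

  term-+ : ∀ p a n k → term (p + a) (p + n) k ≡ term a n k
  term-+ p a n k = ≡.cong₂ (λ b m → if b then op m k else 0) (+-≤ᵇ-+ p a n) (ℕₚ.[m+n]∸[m+o]≡n∸o p n a)

  -- Removing one copy of the part p lowers its multiplicity by one; multiplicity 1 becomes
  -- multiplicity 0, which contributes `op n k`.
  opMult-shift : ∀ n p k f → opMult (p + n) p k (suc f) ≡ op n k + opMult n p k f
  opMult-shift n p k zero    = ≡.cong (_+ 0) (term-+ p 0 n k)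
  opMult-shift n p k (suc f) = begin
    term (p + suc f * p) (p + n) k + opMult (p + n) p k (suc f)
      ≡⟨ ≡.cong₂ _+_ (term-+ p (suc f * p) n k) (opMult-shift n p k f) ⟩
    term (suc f * p) n k + (op n k + opMult n p k f)
      ≡⟨ x∙yz≈y∙xz (term (suc f * p) n k) (op n k) _ ⟩
    op n k + opMult n p k (suc f) ∎
    where
    open ≡.≡-Reasoning

  -- A multiplicity above n contributes nothing, as the parts are positive. This absorbs the fuel k
  -- + n left by the shift, where `op n (suc k)` runs with fuel n.
  opMult-fuel : ∀ n p k j → opMult n (suc p) k (j + n) ≡ opMult n (suc p) k n
  opMult-fuel n p k zero    = ≡.refl
  opMult-fuel n p k (suc j) = ≡.cong₂ _+_
    (term-> k (ℕₚ.<-≤-trans (s≤s (ℕₚ.m≤n+m n j)) (ℕₚ.m≤m*n (suc (j + n)) (suc p))))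
    (opMult-fuel n p k j)

  -- The coefficient of q^(k+1+n) in (1 - q^(k+1)) O(k+1) = (1 + q^(k+1)) O(k), with O(k) the
  -- generating function of `op _ k`.
  op-+ : ∀ n k → op (suc k + n) (suc k) ≡ op (suc k + n) k + (op n k + op n (suc k))
  op-+ n k = begin
    op (suc k + n) (suc k)                                       ≡⟨⟩
    op (suc k + n) k + 2 * opMult (suc k + n) (suc k) k (suc (k + n))
      ≡⟨ ≡.cong (λ m → op (suc k + n) k + 2 * m) (≡.trans (opMult-shift n (suc k) k (k + n)) (≡.cong (op n k +_) (opMult-fuel n k k k))) ⟩
    op (suc k + n) k + 2 * (op n k + opMult n (suc k) k n)
      ≡⟨ ≡.cong (op (suc k + n) k +_) (solve 2 (λ a m → con 2 :* (a :+ m) := a :+ (a :+ con 2 :* m)) ≡.refl (op n k) (opMult n (suc k) k n)) ⟩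
    op (suc k + n) k + (op n k + (op n k + 2 * opMult n (suc k) k n))
      ≡⟨ ≡.cong (λ m → op (suc k + n) k + (op n k + m)) (op-suc n k) ⟨
    op (suc k + n) k + (op n k + op n (suc k)) ∎
    where
    open ≡.≡-Reasoning
    open +-*-Solver using (solve; _:+_; _:*_; _:=_; con)

  op-≤ : ∀ {n k} → n ≤ k → op n (suc k) ≡ op n k
  op-≤ {n} {k} n≤k = ≡.trans (op-suc n k) (≡.trans (≡.cong (λ m → op n k + 2 * m) (go n)) (ℕₚ.+-identityʳ _))
    where
    go : ∀ f → opMult n (suc k) k f ≡ 0
    go zero    = ≡.refl
    go (suc f) = ≡.cong₂ _+_ (term-> k (ℕₚ.≤-trans (s≤s n≤k) (ℕₚ.m≤m+n (suc k) (f * suc k)))) (go f)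

  op≡overpartitions : ∀ {n k} → n ≤ k → op n k ≡ overpartitions n
  op≡overpartitions n≤k = go (ℕₚ.≤⇒≤′ n≤k)
    where
    go : ∀ {n k} → n ≤′ k → op n k ≡ overpartitions n
    go ≤′-refl       = ≡.refl
    go (≤′-step n≤k) = ≡.trans (op-≤ (ℕₚ.≤′⇒≤ n≤k)) (go n≤k)

-- The ring of integers modulo m.

import Data.Integer

module IntegersMod (m : Data.Integer.ℤ) where

  open import Data.Integer as ℤ using (ℤ; +_)
  import Data.Integer.Properties as ℤₚ
  open import Data.Integer.Divisibility.Signed as Signed using (divides)
  open import Data.Integer.Solver using (module +-*-Solver)
  open import Data.Product using (_,_)
  open import Level using (0ℓ)
  open import Relation.Binary using (IsEquivalence)
  open import Relation.Binary.PropositionalEquality as ≡ using (_≡_)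

  infix 4 _≅_
  -- A record keeps `a` and `b` recoverable from the type of a proof; the difference in `m ∣ a - b`
  -- does not determine them.
  record _≅_ (a b : ℤ) : Set where
    constructor congruent
    field divisible : m Signed.∣ a ℤ.- b

  open _≅_ public

  ≡⇒≅ : ∀ {a b} → a ≡ b → a ≅ b
  ≡⇒≅ {a} ≡.refl = congruent (divides (+ 0) (ℤₚ.+-inverseʳ a))

  ≅-isEquivalence : IsEquivalence _≅_
  ≅-isEquivalence = record
    { refl  = ≡⇒≅ ≡.refl
    ; sym   = λ {a} {b} p → congruent (≡.subst (m Signed.∣_)
        (solve 2 (λ a b → :- (a :- b) := b :- a) ≡.refl a b) (Signed.∣m⇒∣-m (divisible p)))
    ; trans = λ {a} {b} {c} p q → congruent (≡.subst (m Signed.∣_)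
        (solve 3 (λ a b c → (a :- b) :+ (b :- c) := a :- c) ≡.refl a b c) (Signed.∣m∣n⇒∣m+n (divisible p) (divisible q)))
    }
    where open +-*-Solver

  ℤ/m : CommutativeRing 0ℓ 0ℓ
  ℤ/m = record
    { Carrier = ℤ ; _≈_ = _≅_ ; _+_ = ℤ._+_ ; _*_ = ℤ._*_ ; -_ = ℤ.-_ ; 0# = + 0 ; 1# = + 1
    ; isCommutativeRing = record
      { isRing = record
        { +-isAbelianGroup = record
          { isGroup = record
            { isMonoid = record
              { isSemigroup = record
                { isMagma = record
                  { isEquivalence = ≅-isEquivalence
                  ; ∙-cong = λ {a} {b} {c} {d} p q → congruent (≡.subst (m Signed.∣_)
                      (solve 4 (λ a b c d → (a :- b) :+ (c :- d) := (a :+ c) :- (b :+ d)) ≡.refl a b c d)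
                      (Signed.∣m∣n⇒∣m+n (divisible p) (divisible q)))
                  }
                ; assoc = λ a b c → ≡⇒≅ (ℤₚ.+-assoc a b c)
                }
              ; identity = (λ a → ≡⇒≅ (ℤₚ.+-identityˡ a)) , (λ a → ≡⇒≅ (ℤₚ.+-identityʳ a))
              }
            ; inverse = (λ a → ≡⇒≅ (ℤₚ.+-inverseˡ a)) , (λ a → ≡⇒≅ (ℤₚ.+-inverseʳ a))
            ; ⁻¹-cong = λ {a} {b} p → congruent (≡.subst (m Signed.∣_)
                (solve 2 (λ a b → :- (a :- b) := :- a :- :- b) ≡.refl a b) (Signed.∣m⇒∣-m (divisible p)))
            }
          ; comm = λ a b → ≡⇒≅ (ℤₚ.+-comm a b)
          }
        ; *-cong = λ {a} {b} {c} {d} p q → congruent (≡.subst (m Signed.∣_)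
            (solve 4 (λ a b c d → (a :- b) :* c :+ b :* (c :- d) := a :* c :- b :* d) ≡.refl a b c d)
            (Signed.∣m∣n⇒∣m+n (Signed.∣m⇒∣m*n c (divisible p)) (Signed.∣n⇒∣m*n b (divisible q))))
        ; *-assoc = λ a b c → ≡⇒≅ (ℤₚ.*-assoc a b c)
        ; *-identity = (λ a → ≡⇒≅ (ℤₚ.*-identityˡ a)) , (λ a → ≡⇒≅ (ℤₚ.*-identityʳ a))
        ; distrib = (λ a b c → ≡⇒≅ (ℤₚ.*-distribˡ-+ a b c)) , (λ a b c → ≡⇒≅ (ℤₚ.*-distribʳ-+ a b c))
        }
      ; *-comm = λ a b → ≡⇒≅ (ℤₚ.*-comm a b)
      }
    }
    where open +-*-Solver

  ≅0⇒∣ : ∀ {a} → a ≅ + 0 → m Signed.∣ a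
  ≅0⇒∣ {a} p = ≡.subst (m Signed.∣_) (ℤₚ.+-identityʳ a) (divisible p)

  ∣⇒≅0 : ∀ {a} → m Signed.∣ a → a ≅ + 0
  ∣⇒≅0 {a} p = congruent (≡.subst (m Signed.∣_) (≡.sym (ℤₚ.+-identityʳ a)) p)

-- Integral quaternions and the congruence r₄(7n) ≡ r₄(n) (mod 7).

module FourSquares where

  open import Data.Empty using (⊥)
  open import Data.Integer as ℤ using (ℤ; +_; -[1+_]; _+_; _*_; -_; _-_)
  open import Data.Integer.Divisibility.Signed as Signed using (_∣_; _∣?_; divides)
  import Data.Integer.Properties as ℤₚ
  open import Data.Integer.Solver using (module +-*-Solver)
  open import Data.Integer.DivMod using (_%ℕ_; _/ℕ_; a≡a%ℕn+[a/ℕn]*n; n%ℕd<d)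
  open import Data.List using (List; []; _∷_; length; filter; cartesianProduct; upTo; map)
  open import Data.List.Membership.Propositional using (_∈_)
  open import Data.List.Membership.Propositional.Properties
  open import Data.List.Membership.Propositional.Properties.WithK using (unique∧set⇒bag)
  open import Data.List.Properties using (filter-≐; length-map)
  open import Data.List.Relation.Binary.BagAndSetEquality using (∼bag⇒↭)
  open import Data.List.Relation.Binary.Permutation.Propositional.Properties using (↭-length)
  open import Data.List.Relation.Unary.All as All using (All; []; _∷_)
  open import Data.List.Relation.Unary.Unique.Propositional using (Unique)
  import Data.List.Relation.Unary.Unique.Propositional.Properties as Unique
  open import Data.Nat as ℕ using (ℕ; zero; suc)
  import Data.Nat.ListAction as ListAction
  import Data.Nat.Properties as ℕₚ
  open import Algebra.Properties.CommutativeSemigroup ℕₚ.+-commutativeSemigroup using (x∙yz≈y∙xz)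
  open import Data.Product using (∃; _×_; _,_; proj₁; proj₂)
  open import Function using (_∘_; mk⇔)
  open import Relation.Nullary using (Dec; yes; no)
  open import Relation.Nullary.Decidable using (_×-dec_; _→-dec_; toWitness)
  open import Relation.Binary.PropositionalEquality as ≡ using (_≡_)
  import Relation.Binary.Reasoning.Setoid as SetoidReasoning

  open IntegersMod (+ 7)
  private module ℤ/7 = CommutativeRing ℤ/m
  open +-*-Solver using (Polynomial; solve; _:+_; _:*_; _:-_; :-_; _:=_; con)

  -- Lipschitz quaternions in the basis 1, i, j, k: exactly the points of ℤ⁴ that r₄ counts, without
  -- Hurwitz' half-integral ones.
  Quaternion : Set
  Quaternion = ℤ × ℤ × ℤ × ℤ

  infixl 6 _⊗_
  _⊗_ : Quaternion → Quaternion → Quaternion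
  (a , b , c , d) ⊗ (e , f , g , h) =
      a * e - b * f - c * g - d * h
    , a * f + b * e + c * h - d * g
    , a * g - b * h + c * e + d * f
    , a * h + b * g - c * f + d * e

  conj : Quaternion → Quaternion
  conj (a , b , c , d) = a , - b , - c , - d

  norm : Quaternion → ℤ
  norm (a , b , c , d) = a * a + b * b + c * c + d * d

  infixr 7 _·_
  _·_ : ℤ → Quaternion → Quaternion
  k · (a , b , c , d) = k * a , k * b , k * c , k * d

  ≡-quaternion : ∀ {a b c d a′ b′ c′ d′ : ℤ} → a ≡ a′ → b ≡ b′ → c ≡ c′ → d ≡ d′ →
                 (a , b , c , d) ≡ (a′ , b′ , c′ , d′)
  ≡-quaternion ≡.refl ≡.refl ≡.refl ≡.refl = ≡.refl

  norm-⊗ : ∀ x y → norm (x ⊗ y) ≡ norm x * norm y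
  norm-⊗ (a , b , c , d) (e , f , g , h) = solve 8 (λ a b c d e f g h →
     let p = a :* e :- b :* f :- c :* g :- d :* h
         q = a :* f :+ b :* e :+ c :* h :- d :* g
         r = a :* g :- b :* h :+ c :* e :+ d :* f
         s = a :* h :+ b :* g :- c :* f :+ d :* e in
     p :* p :+ q :* q :+ r :* r :+ s :* s
       := (a :* a :+ b :* b :+ c :* c :+ d :* d) :* (e :* e :+ f :* f :+ g :* g :+ h :* h))
    ≡.refl a b c d e f g h

  conj-⊗-⊗ : ∀ x y → conj x ⊗ (x ⊗ y) ≡ norm x · y
  conj-⊗-⊗ (a , b , c , d) (e , f , g , h) = ≡-quaternion
    (solve 8 (λ a b c d e f g h →
      a :* P a b c d e f g h :- :- b :* Q a b c d e f g h :- :- c :* R a b c d e f g h :- :- d :* S a b c d e f g h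
        := N a b c d :* e) ≡.refl a b c d e f g h)
    (solve 8 (λ a b c d e f g h →
      a :* Q a b c d e f g h :+ :- b :* P a b c d e f g h :+ :- c :* S a b c d e f g h :- :- d :* R a b c d e f g h
        := N a b c d :* f) ≡.refl a b c d e f g h)
    (solve 8 (λ a b c d e f g h →
      a :* R a b c d e f g h :- :- b :* S a b c d e f g h :+ :- c :* P a b c d e f g h :+ :- d :* Q a b c d e f g h
        := N a b c d :* g) ≡.refl a b c d e f g h)
    (solve 8 (λ a b c d e f g h →
      a :* S a b c d e f g h :+ :- b :* R a b c d e f g h :- :- c :* Q a b c d e f g h :+ :- d :* P a b c d e f g h
        := N a b c d :* h) ≡.refl a b c d e f g h)
    where
    P Q R S : ∀ {n} (a b c d e f g h : Polynomial n) → Polynomial n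
    P a b c d e f g h = a :* e :- b :* f :- c :* g :- d :* h
    Q a b c d e f g h = a :* f :+ b :* e :+ c :* h :- d :* g
    R a b c d e f g h = a :* g :- b :* h :+ c :* e :+ d :* f
    S a b c d e f g h = a :* h :+ b :* g :- c :* f :+ d :* e
    N : ∀ {n} (a b c d : Polynomial n) → Polynomial n
    N a b c d = a :* a :+ b :* b :+ c :* c :+ d :* d

  conj-involutive : ∀ x → conj (conj x) ≡ x
  conj-involutive (a , b , c , d) = ≡-quaternion ≡.refl
    (ℤₚ.neg-involutive b) (ℤₚ.neg-involutive c) (ℤₚ.neg-involutive d)

  norm-conj : ∀ x → norm (conj x) ≡ norm x
  norm-conj (a , b , c , d) = solve 4 (λ a b c d →
    a :* a :+ :- b :* :- b :+ :- c :* :- c :+ :- d :* :- d := a :* a :+ b :* b :+ c :* c :+ d :* d) ≡.refl a b c d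

  ⊗-conj-⊗ : ∀ x y → x ⊗ (conj x ⊗ y) ≡ norm x · y
  ⊗-conj-⊗ x y = ≡.trans (≡.cong (_⊗ (conj x ⊗ y)) (≡.sym (conj-involutive x)))
    (≡.trans (conj-⊗-⊗ (conj x) y) (≡.cong (_· y) (norm-conj x)))

  ·-cancelˡ : ∀ k x y .{{_ : ℤ.NonZero k}} → k · x ≡ k · y → x ≡ y
  ·-cancelˡ k (a , b , c , d) (e , f , g , h) eq = ≡-quaternion
    (ℤₚ.*-cancelˡ-≡ k _ _ (≡.cong proj₁ eq))
    (ℤₚ.*-cancelˡ-≡ k _ _ (≡.cong (proj₁ ∘ proj₂) eq))
    (ℤₚ.*-cancelˡ-≡ k _ _ (≡.cong (proj₁ ∘ proj₂ ∘ proj₂) eq))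
    (ℤₚ.*-cancelˡ-≡ k _ _ (≡.cong (proj₂ ∘ proj₂ ∘ proj₂) eq))

  ⊗-·-comm : ∀ k x y → x ⊗ k · y ≡ k · (x ⊗ y)
  ⊗-·-comm k (a , b , c , d) (e , f , g , h) = ≡-quaternion
    (solve 9 (λ k a b c d e f g h →
      a :* (k :* e) :- b :* (k :* f) :- c :* (k :* g) :- d :* (k :* h)
        := k :* (a :* e :- b :* f :- c :* g :- d :* h)) ≡.refl k a b c d e f g h)
    (solve 9 (λ k a b c d e f g h →
      a :* (k :* f) :+ b :* (k :* e) :+ c :* (k :* h) :- d :* (k :* g)
        := k :* (a :* f :+ b :* e :+ c :* h :- d :* g)) ≡.refl k a b c d e f g h)
    (solve 9 (λ k a b c d e f g h →
      a :* (k :* g) :- b :* (k :* h) :+ c :* (k :* e) :+ d :* (k :* f)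
        := k :* (a :* g :- b :* h :+ c :* e :+ d :* f)) ≡.refl k a b c d e f g h)
    (solve 9 (λ k a b c d e f g h →
      a :* (k :* h) :+ b :* (k :* g) :- c :* (k :* f) :+ d :* (k :* e)
        := k :* (a :* h :+ b :* g :- c :* f :+ d :* e)) ≡.refl k a b c d e f g h)

  infix 4 _∣ᵠ_ _∣ᵠ?_ _≅ᵠ_
  _∣ᵠ_ : ℤ → Quaternion → Set
  m ∣ᵠ (a , b , c , d) = (m ∣ a) × (m ∣ b) × (m ∣ c) × (m ∣ d)

  _∣ᵠ?_ : ∀ m x → Dec (m ∣ᵠ x)
  m ∣ᵠ? (a , b , c , d) = (m ∣? a) ×-dec (m ∣? b) ×-dec (m ∣? c) ×-dec (m ∣? d)

  ∣ᵠ-· : ∀ m x → m ∣ᵠ m · x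
  ∣ᵠ-· m (a , b , c , d) = Signed.∣m⇒∣m*n a Signed.∣-refl , Signed.∣m⇒∣m*n b Signed.∣-refl
                         , Signed.∣m⇒∣m*n c Signed.∣-refl , Signed.∣m⇒∣m*n d Signed.∣-refl

  ∣ᵠ⇒· : ∀ m x → m ∣ᵠ x → ∃ λ y → x ≡ m · y
  ∣ᵠ⇒· m x (divides a p , divides b q , divides c r , divides d s) = (a , b , c , d) , ≡-quaternion
    (≡.trans p (ℤₚ.*-comm a m)) (≡.trans q (ℤₚ.*-comm b m)) (≡.trans r (ℤₚ.*-comm c m)) (≡.trans s (ℤₚ.*-comm d m))

  _≅ᵠ_ : Quaternion → Quaternion → Set
  (a , b , c , d) ≅ᵠ (e , f , g , h) = a ≅ e × b ≅ f × c ≅ g × d ≅ h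

  ⊗-congˡ : ∀ x {y z} → y ≅ᵠ z → x ⊗ y ≅ᵠ x ⊗ z
  ⊗-congˡ (a , b , c , d) (p , q , r , s) =
      +-cong (+-cong (+-cong (*-congˡ {a} p) (-‿cong (*-congˡ {b} q))) (-‿cong (*-congˡ {c} r))) (-‿cong (*-congˡ {d} s))
    , +-cong (+-cong (+-cong (*-congˡ {a} q) (*-congˡ {b} p)) (*-congˡ {c} s)) (-‿cong (*-congˡ {d} r))
    , +-cong (+-cong (+-cong (*-congˡ {a} r) (-‿cong (*-congˡ {b} s))) (*-congˡ {c} p)) (*-congˡ {d} q)
    , +-cong (+-cong (+-cong (*-congˡ {a} s) (*-congˡ {b} r)) (-‿cong (*-congˡ {c} q))) (*-congˡ {d} p)
    where open ℤ/7

  norm-cong : ∀ {x y} → x ≅ᵠ y → norm x ≅ norm y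
  norm-cong (p , q , r , s) = +-cong (+-cong (+-cong (*-cong p p) (*-cong q q)) (*-cong r r)) (*-cong s s)
    where open ℤ/7

  ≅ᵠ-sym : ∀ {x y} → x ≅ᵠ y → y ≅ᵠ x
  ≅ᵠ-sym (p , q , r , s) = ℤ/7.sym p , ℤ/7.sym q , ℤ/7.sym r , ℤ/7.sym s

  ∣ᵠ-resp-≅ᵠ : ∀ {x y} → x ≅ᵠ y → + 7 ∣ᵠ x → + 7 ∣ᵠ y
  ∣ᵠ-resp-≅ᵠ (p , q , r , s) (p′ , q′ , r′ , s′) = go p p′ , go q q′ , go r r′ , go s s′
    where
    go : ∀ {a b} → a ≅ b → + 7 ∣ a → + 7 ∣ b
    go a≅b 7∣a = ≅0⇒∣ (ℤ/7.trans (ℤ/7.sym a≅b) (∣⇒≅0 7∣a))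

  -- Since 7 = 4 + 1 + 1 + 1 is the only way to write 7 as four squares, every quaternion of norm 7
  -- has one entry ±2 and three entries ±1. Right multiplication by exactly one of the units ±1, ±i,
  -- ±j, ±k makes its real part 2, so these represent norm 7 up to right units.
  norm7 : List Quaternion
  norm7 = map (+ 2 ,_) (cartesianProduct ±1 (cartesianProduct ±1 ±1))
    where ±1 = + 1 ∷ -[1+ 0 ] ∷ []

  norm7-norm : ∀ {α} → α ∈ norm7 → norm α ≡ + 7
  norm7-norm = All.lookup (toWitness {a? = All.all? (λ α → norm α ℤ.≟ + 7) norm7} _)

  -- For norm α = 7, x = αy is solvable in integral quaternions if and only if 7 divides conj(α) x.
  -- This form of the condition is decidable and depends only on x modulo 7.
  leftDivisors : Quaternion → List Quaternion
  leftDivisors x = filter (λ α → + 7 ∣ᵠ? conj α ⊗ x) norm7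

  leftDivisors-cong : ∀ {x y} → x ≅ᵠ y → leftDivisors x ≡ leftDivisors y
  leftDivisors-cong {x} {y} x≅y = filter-≐ (λ α → + 7 ∣ᵠ? conj α ⊗ x) (λ α → + 7 ∣ᵠ? conj α ⊗ y)
    ((λ {α} → ∣ᵠ-resp-≅ᵠ (⊗-congˡ (conj α) x≅y)) , (λ {α} → ∣ᵠ-resp-≅ᵠ (⊗-congˡ (conj α) (≅ᵠ-sym {x} {y} x≅y)))) norm7

  residue : ℤ → ℤ
  residue a = + (a %ℕ 7)

  ≅-residue : ∀ a → a ≅ residue a
  ≅-residue a = congruent (divides (a /ℕ 7) (≡.trans (≡.cong (_- residue a) (a≡a%ℕn+[a/ℕn]*n a 7))
    (solve 2 (λ r q → (r :+ q :* con (+ 7)) :- r := q :* con (+ 7)) ≡.refl (residue a) (a /ℕ 7))))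

  residues : List ℤ
  residues = map +_ (upTo 7)

  residue∈residues : ∀ a → residue a ∈ residues
  residue∈residues a = ∈-map⁺ +_ (∈-upTo⁺ (n%ℕd<d a 7))

  -- An isotropic x ≢ 0 over 𝔽₇ lies in exactly one of the eight planes α𝔽₇⁴ with
  -- α ∈ norm7, and x ≡ 0 lies in all eight of them.
  length-leftDivisors : ∀ x → + 7 ∣ norm x → + length (leftDivisors x) ≅ + 1
  length-leftDivisors x@(a , b , c , d) 7∣norm = congruent (≡.subst (λ l → + 7 ∣ + length l - + 1)
    (≡.sym (leftDivisors-cong x≅r)) (All.lookup check r∈ (≅0⇒∣ (ℤ/7.trans (ℤ/7.sym (norm-cong {x} {r} x≅r)) (∣⇒≅0 7∣norm)))))
    where
    r = residue a , residue b , residue c , residue d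
    x≅r : x ≅ᵠ r
    x≅r = ≅-residue a , ≅-residue b , ≅-residue c , ≅-residue d
    𝔽₇⁴ = cartesianProduct residues (cartesianProduct residues (cartesianProduct residues residues))
    r∈ : r ∈ 𝔽₇⁴
    r∈ = ∈-cartesianProduct⁺ (residue∈residues a) (∈-cartesianProduct⁺ (residue∈residues b)
           (∈-cartesianProduct⁺ (residue∈residues c) (residue∈residues d)))
    check : All (λ x → + 7 ∣ norm x → + 7 ∣ + length (leftDivisors x) - + 1) 𝔽₇⁴
    check = toWitness {a? = All.all? (λ x → (+ 7 ∣? norm x) →-dec (+ 7 ∣? + length (leftDivisors x) - + 1)) 𝔽₇⁴} _

  square : ℤ → ℕ
  square a = ℤ.∣ a ∣ ℕ.* ℤ.∣ a ∣

  a*a≡+square : ∀ a → a * a ≡ + square a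
  a*a≡+square (+ n)      = ≡.sym (ℤₚ.pos-* n n)
  a*a≡+square (-[1+ n ]) = ≡.refl

  ∣a∣≤square : ∀ a → ℤ.∣ a ∣ ℕ.≤ square a
  ∣a∣≤square a = go ℤ.∣ a ∣
    where
    go : ∀ n → n ℕ.≤ n ℕ.* n
    go zero    = ℕ.z≤n
    go (suc n) = ℕₚ.m≤m*n (suc n) (suc n)

  norm≡+squares : ∀ a b c d → norm (a , b , c , d) ≡ + (square a ℕ.+ square b ℕ.+ square c ℕ.+ square d)
  norm≡+squares a b c d = ≡.cong₂ _+_ (≡.cong₂ _+_ (≡.cong₂ _+_ (a*a≡+square a) (a*a≡+square b)) (a*a≡+square c)) (a*a≡+square d)

  ∈-range⁺ : ∀ {n} a → ℤ.∣ a ∣ ℕ.≤ n → a ∈ range n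
  ∈-range⁺ (+ k)      k≤n = ∈-++⁺ˡ (∈-map⁺ +_ (∈-upTo⁺ (ℕ.s≤s k≤n)))
  ∈-range⁺ (-[1+ k ]) k<n = ∈-++⁺ʳ _ (∈-map⁺ -[1+_] (∈-upTo⁺ k<n))

  range-unique : ∀ n → Unique (range n)
  range-unique n = Unique.++⁺ (Unique.map⁺ ℤₚ.+-injective (Unique.upTo⁺ (suc n)))
    (Unique.map⁺ ℤₚ.-[1+-injective (Unique.upTo⁺ n)) disjoint
    where
    disjoint : ∀ {a} → a ∈ map +_ (upTo (suc n)) × a ∈ map -[1+_] (upTo n) → ⊥
    disjoint (p , q) with ∈-map⁻ +_ p | ∈-map⁻ -[1+_] q
    ... | _ , _ , ≡.refl | _ , _ , ()

  box : ℕ → List Quaternion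
  box n = cartesianProduct (range n) (cartesianProduct (range n) (cartesianProduct (range n) (range n)))

  -- Its length is r₄(n): each coordinate satisfies |a| ≤ a² ≤ n, so the box contains every
  -- solution.
  ofNorm : ℕ → List Quaternion
  ofNorm n = filter (λ x → norm x ℤ.≟ + n) (box n)

  ofNorm-unique : ∀ n → Unique (ofNorm n)
  ofNorm-unique n = Unique.filter⁺ (λ x → norm x ℤ.≟ + n) 
    (Unique.cartesianProduct⁺ u (Unique.cartesianProduct⁺ u (Unique.cartesianProduct⁺ u u)))
    where u = range-unique n

  ∈-ofNorm⁻ : ∀ {n x} → x ∈ ofNorm n → norm x ≡ + n
  ∈-ofNorm⁻ {n} p = proj₂ (∈-filter⁻ (λ x → norm x ℤ.≟ + n) {xs = box n} p)

  ∈-ofNorm⁺ : ∀ {n x} → norm x ≡ + n → x ∈ ofNorm n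
  ∈-ofNorm⁺ {n} {a , b , c , d} eq = ∈-filter⁺ (λ x → norm x ℤ.≟ + n)
    (∈-cartesianProduct⁺ (in-range a (≤-trans (m≤m+n _ _) (≤-trans (m≤m+n _ _) (m≤m+n _ _))))
    (∈-cartesianProduct⁺ (in-range b (≤-trans (m≤n+m _ (square a)) (≤-trans (m≤m+n _ _) (m≤m+n _ _))))
    (∈-cartesianProduct⁺ (in-range c (≤-trans (m≤n+m _ (square a ℕ.+ square b)) (m≤m+n _ _)))
                         (in-range d (m≤n+m _ (square a ℕ.+ square b ℕ.+ square c)))))) eq
    where
    open ℕₚ using (≤-trans; m≤m+n; m≤n+m)
    in-range : ∀ z → square z ℕ.≤ square a ℕ.+ square b ℕ.+ square c ℕ.+ square d → z ∈ range n
    in-range z z²≤ = ∈-range⁺ z (≤-trans (∣a∣≤square z)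
      (≡.subst (square z ℕ.≤_) (ℤₚ.+-injective (≡.trans (≡.sym (norm≡+squares a b c d)) eq)) z²≤))

  -- Left multiplication by α multiplies norms by 7 and is undone by conj(α) up to the factor 7. The
  -- lengths agree because duplicate-free lists with the same members are permutations of each
  -- other.
  length-multiples : ∀ {α} → α ∈ norm7 → ∀ n →
    length (filter (λ x → + 7 ∣ᵠ? conj α ⊗ x) (ofNorm (7 ℕ.* n))) ≡ length (ofNorm n)
  length-multiples {α} α∈ n = ≡.sym (≡.trans (≡.sym (length-map (α ⊗_) (ofNorm n)))
    (↭-length (∼bag⇒↭ (unique∧set⇒bag (Unique.map⁺ injective (ofNorm-unique n))
      (Unique.filter⁺ div? (ofNorm-unique (7 ℕ.* n))) (mk⇔ to from)))))
    where
    div? = λ x → + 7 ∣ᵠ? conj α ⊗ x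

    conj-α⊗α⊗ : ∀ y → conj α ⊗ (α ⊗ y) ≡ + 7 · y
    conj-α⊗α⊗ y = ≡.trans (conj-⊗-⊗ α y) (≡.cong (_· y) (norm7-norm α∈))

    norm-α⊗ : ∀ y → norm (α ⊗ y) ≡ + 7 * norm y
    norm-α⊗ y = ≡.trans (norm-⊗ α y) (≡.cong (_* norm y) (norm7-norm α∈))

    injective : ∀ {x y} → α ⊗ x ≡ α ⊗ y → x ≡ y
    injective {x} {y} eq = ·-cancelˡ (+ 7) x y
      (≡.trans (≡.sym (conj-α⊗α⊗ x)) (≡.trans (≡.cong (conj α ⊗_) eq) (conj-α⊗α⊗ y)))

    to : ∀ {x} → x ∈ map (α ⊗_) (ofNorm n) → x ∈ filter div? (ofNorm (7 ℕ.* n))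
    to x∈ with ∈-map⁻ (α ⊗_) x∈
    ... | y , y∈ , ≡.refl = ∈-filter⁺ div? (∈-ofNorm⁺ (≡.trans (norm-α⊗ y)
        (≡.trans (≡.cong (+ 7 *_) (∈-ofNorm⁻ {n} y∈)) (≡.sym (ℤₚ.pos-* 7 n)))))
      (≡.subst (+ 7 ∣ᵠ_) (≡.sym (conj-α⊗α⊗ y)) (∣ᵠ-· (+ 7) y))

    from : ∀ {x} → x ∈ filter div? (ofNorm (7 ℕ.* n)) → x ∈ map (α ⊗_) (ofNorm n)
    from {x} x∈ with ∈-filter⁻ div? {xs = ofNorm (7 ℕ.* n)} x∈
    ... | x∈₇ₙ , 7∣ with ∣ᵠ⇒· (+ 7) (conj α ⊗ x) 7∣
    ... | y , eq = ≡.subst (_∈ map (α ⊗_) (ofNorm n)) α⊗y≡x (∈-map⁺ (α ⊗_) (∈-ofNorm⁺ norm-y))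
      where
      α⊗y≡x : α ⊗ y ≡ x
      -- From conj(α) x = 7y: 7 (αy) = α (7y) = α (conj(α) x) = 7x.
      α⊗y≡x = ·-cancelˡ (+ 7) (α ⊗ y) x (≡.trans (≡.sym (⊗-·-comm (+ 7) α y))
        (≡.trans (≡.cong (α ⊗_) (≡.sym eq)) (≡.trans (⊗-conj-⊗ α x) (≡.cong (_· x) (norm7-norm α∈)))))
      norm-y : norm y ≡ + n
      norm-y = ℤₚ.*-cancelˡ-≡ (+ 7) (norm y) (+ n) (≡.trans (≡.sym (norm-α⊗ y))
        (≡.trans (≡.cong norm α⊗y≡x) (≡.trans (∈-ofNorm⁻ {7 ℕ.* n} x∈₇ₙ) (ℤₚ.pos-* 7 n))))

  module _ {A B : Set} {P : A → B → Set} (P? : ∀ a b → Dec (P a b)) where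

    rowCount : A → List B → ℕ
    rowCount x ys = length (filter (P? x) ys)

    columnCount : List A → B → ℕ
    columnCount xs y = length (filter (λ x → P? x y) xs)

    double-count : ∀ xs ys → ListAction.sum (map (λ x → rowCount x ys) xs) ≡ ListAction.sum (map (columnCount xs) ys)
    double-count []       ys = ≡.sym (zeros ys)
      where
      zeros : ∀ (ys : List B) → ListAction.sum (map (λ _ → 0) ys) ≡ 0
      zeros []       = ≡.refl
      zeros (_ ∷ ys) = zeros ys
    double-count (x ∷ xs) ys = ≡.trans (≡.cong (rowCount x ys ℕ.+_) (double-count xs ys)) (add ys)
      where
      add : ∀ ys → rowCount x ys ℕ.+ ListAction.sum (map (columnCount xs) ys) ≡ ListAction.sum (map (columnCount (x ∷ xs)) ys)
      step : ∀ y ys → rowCount x ys ℕ.+ (columnCount xs y ℕ.+ ListAction.sum (map (columnCount xs) ys))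
                    ≡ columnCount xs y ℕ.+ ListAction.sum (map (columnCount (x ∷ xs)) ys)
      add []       = ≡.refl
      add (y ∷ ys) with P? x y
      ... | yes _ = ≡.cong suc (step y ys)
      ... | no  _ = step y ys
      step y ys = ≡.trans (x∙yz≈y∙xz (rowCount x ys) (columnCount xs y) _) (≡.cong (columnCount xs y ℕ.+_) (add ys))

  -- The pairs (α, x) with α dividing x are counted twice: each x of norm 7n contributes a number ≡
  -- 1, and each of the 8 ≡ 1 quaternions α contributes r₄(n).
  length-ofNorm-7* : ∀ n → + length (ofNorm (7 ℕ.* n)) ≅ + length (ofNorm n)
  length-ofNorm-7* n = begin
    + length (ofNorm (7 ℕ.* n))
      ≈⟨ sum-ones (ofNorm (7 ℕ.* n)) (All.tabulate λ {x} x∈ → length-leftDivisors x (7∣ x∈)) ⟨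
    + ListAction.sum (map (length ∘ leftDivisors) (ofNorm (7 ℕ.* n)))
      ≡⟨ ≡.cong +_ (double-count (λ α x → + 7 ∣ᵠ? conj α ⊗ x) norm7 (ofNorm (7 ℕ.* n))) ⟨
    + ListAction.sum (map (λ α → length (filter (λ x → + 7 ∣ᵠ? conj α ⊗ x) (ofNorm (7 ℕ.* n)))) norm7)
      ≡⟨ ≡.cong +_ (sum-constant norm7 (All.tabulate λ α∈ → length-multiples α∈ n)) ⟩
    + (8 ℕ.* length (ofNorm n))                          ≡⟨ ℤₚ.pos-* 8 (length (ofNorm n)) ⟩
    + 8 * + length (ofNorm n)
      ≈⟨ ℤ/7.*-congʳ {+ length (ofNorm n)} {+ 8} {+ 1} (congruent (divides (+ 1) ≡.refl)) ⟩
    + 1 * + length (ofNorm n)                            ≡⟨ ℤₚ.*-identityˡ _ ⟩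
    + length (ofNorm n)                                  ∎
    where
    open SetoidReasoning ℤ/7.setoid
    7∣ : ∀ {x} → x ∈ ofNorm (7 ℕ.* n) → + 7 ∣ norm x
    7∣ x∈ = divides (+ n) (≡.trans (∈-ofNorm⁻ {7 ℕ.* n} x∈) (≡.trans (ℤₚ.pos-* 7 n) (ℤₚ.*-comm (+ 7) (+ n))))
    sum-ones : ∀ {A : Set} {f : A → ℕ} (xs : List A) → All (λ x → + f x ≅ + 1) xs →
               + ListAction.sum (map f xs) ≅ + length xs
    sum-ones []       []       = ℤ/7.refl
    sum-ones (x ∷ xs) (p ∷ ps) = ℤ/7.+-cong p (sum-ones xs ps)
    sum-constant : ∀ {A : Set} {f : A → ℕ} {k} (xs : List A) → All (λ x → f x ≡ k) xs →
                   ListAction.sum (map f xs) ≡ length xs ℕ.* k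
    sum-constant []       []       = ≡.refl
    sum-constant (x ∷ xs) (p ∷ ps) = ≡.cong₂ ℕ._+_ p (sum-constant xs ps)

-- Generating functions modulo 7 and the congruence for overpartition triples.

module OverpartitionTriples where

  import Algebra.Properties.Semiring.Exp as Exp
  import Algebra.Solver.Ring.NaturalCoefficients.Default as SemiringSolver
  open import Data.Integer as ℤ using (ℤ; +_; -[1+_])
  import Data.Integer.Divisibility.Signed as Signed
  import Data.Integer.Properties as ℤₚ
  open import Data.List using (List; []; _∷_; _∷ʳ_; map; length; filter; upTo; applyUpTo; concatMap; cartesianProduct)
  import Data.List.Properties as Listₚ
  open import Data.List.Relation.Unary.All as All using (All)
  open import Data.Nat as ℕ using (ℕ; zero; suc)
  import Data.Nat.ListAction as ListAction
  import Data.Nat.Properties as ℕₚ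
  open import Data.Product using (_,_)
  open import Function using (_∘_)
  open import Relation.Binary.PropositionalEquality as ≡ using (_≡_; _≢_)
  open import Relation.Nullary using (yes; no)
  open import Relation.Nullary.Decidable using (toWitness)
  import Relation.Binary.Reasoning.Setoid as SetoidReasoning
  open Overpartitions
  open FourSquares

  open IntegersMod (+ 7)
  private
    module ℤ/7 where
      open CommutativeRing ℤ/m public
      open Exp semiring public using (_^_; ^-congˡ)
  open PowerSeries ℤ/m
  open GaussIdentity ℤ/m using (gauss)
  open Frobenius ℤ/m using (multisect; multisect-^7-*)
  open CommutativeRing seriesRing
  open Exp semiring using (^-congˡ; ^-homo-*)
  open ListSum seriesRing
  open SemiringSolver commutativeSemiring using (solve; _:+_; _:*_; _:^_; _:=_; con)

  ℤ/7-^ : ∀ a n → a ℤ/7.^ n ≡ a ℤ.^ n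
  ℤ/7-^ a zero    = ≡.refl
  ℤ/7-^ a (suc n) = ≡.cong (a ℤ.*_) (ℤ/7-^ a n)

  fermat : ∀ a → a ℤ/7.^ 7 ≅ a
  fermat a = ℤ/7.trans (ℤ/7.^-congˡ 7 (≅-residue a)) (ℤ/7.trans
    (congruent (All.lookup check (residue∈residues a))) (ℤ/7.sym (≅-residue a)))
    where
    check : All (λ r → + 7 Signed.∣ r ℤ/7.^ 7 ℤ.- r) residues
    check = toWitness {a? = All.all? (λ r → + 7 Signed.∣? r ℤ/7.^ 7 ℤ.- r) residues} _

  fromℕ : (ℕ → ℕ) → Series
  coeff (fromℕ f) n = + f n

  convolve : (ℕ → ℕ) → (ℕ → ℕ) → ℕ → ℕ
  convolve f g n = ListAction.sum (map (λ a → f a ℕ.* g (n ℕ.∸ a)) (upTo (suc n)))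

  -- The sum is first written with `applyUpTo`, which like `_⊛_` recurses by passing from f to
  -- `f ∘ suc`.
  fromℕ-* : ∀ f g → fromℕ f * fromℕ g ≈ fromℕ (convolve f g)
  fromℕ-* f g = pointwise λ n → ℤ/7.trans (go n f)
    (ℤ/7.reflexive (≡.cong (λ l → + ListAction.sum l) (≡.sym (Listₚ.map-upTo _ (suc n)))))
    where
    go : ∀ n f → coeff (fromℕ f * fromℕ g) n ≅ + ListAction.sum (applyUpTo (λ a → f a ℕ.* g (n ℕ.∸ a)) (suc n))
    go zero    f = ≡⇒≅ (≡.trans (≡.sym (ℤₚ.pos-* (f 0) (g 0))) (≡.cong +_ (≡.sym (ℕₚ.+-identityʳ _))))
    go (suc n) f = ℤ/7.+-cong (≡⇒≅ (≡.sym (ℤₚ.pos-* (f 0) (g (suc n)))))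
      (ℤ/7.trans (⊛-cong-≤ {f′ = fromℕ (f ∘ suc)} n (λ _ _ → ℤ/7.refl) (λ _ _ → ℤ/7.refl)) (go n (f ∘ suc)))

  P : Series
  P = fromℕ overpartitions

  -- As `n ∸ a ∸ b` associates to the left, for fixed a the sum over b is a convolution at `n ∸ a`.
  p̄₃≡convolve : ∀ n → p̄₃ n ≡ convolve overpartitions (convolve overpartitions overpartitions) n
  p̄₃≡convolve n = ≡.cong ListAction.sum (Listₚ.map-cong (λ a → inner a (n ℕ.∸ a)) (upTo (suc n)))
    where
    inner : ∀ a m → ListAction.sum (map (λ b → overpartitions a ℕ.* overpartitions b ℕ.* overpartitions (m ℕ.∸ b)) (upTo (suc m)))
          ≡ overpartitions a ℕ.* convolve overpartitions overpartitions m
    inner a m = go (upTo (suc m))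
      where
      go : ∀ bs → ListAction.sum (map (λ b → overpartitions a ℕ.* overpartitions b ℕ.* overpartitions (m ℕ.∸ b)) bs)
         ≡ overpartitions a ℕ.* ListAction.sum (map (λ b → overpartitions b ℕ.* overpartitions (m ℕ.∸ b)) bs)
      go []       = ≡.sym (ℕₚ.*-zeroʳ (overpartitions a))
      go (b ∷ bs) = ≡.trans (≡.cong₂ ℕ._+_ (ℕₚ.*-assoc (overpartitions a) (overpartitions b) _) (go bs))
        (≡.sym (ℕₚ.*-distribˡ-+ (overpartitions a) (overpartitions b ℕ.* overpartitions (m ℕ.∸ b)) _))

  coeff-P*P*P : ∀ n → coeff (P * (P * P)) n ≅ + p̄₃ n
  coeff-P*P*P n = ℤ/7.trans
    (at (trans (*-congˡ (fromℕ-* overpartitions overpartitions)) (fromℕ-* overpartitions _)) n)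
    (≡⇒≅ (≡.cong +_ (≡.sym (p̄₃≡convolve n))))

  O : ℕ → Series
  O k = fromℕ (λ n → op n k)

  O-zero : O 0 ≈ 1#
  O-zero = pointwise λ where
    zero    → ℤ/7.refl
    (suc n) → ℤ/7.refl

  O-suc : ∀ k → O (suc k) ≈ O k + X ^ suc k * (O k + O (suc k))
  O-suc k = pointwise go
    where
    go : ∀ n → coeff (O (suc k)) n ≅ coeff (O k + X ^ suc k * (O k + O (suc k))) n
    go n with n ℕ.≤? k
    ... | yes n≤k = ℤ/7.trans (≡⇒≅ (≡.cong +_ (op-≤ n≤k))) (ℤ/7.trans (ℤ/7.sym (ℤ/7.+-identityʳ (+ op n k)))
      (ℤ/7.+-congˡ {+ op n k} (ℤ/7.sym (X^-⊛-< (suc k) (O k + O (suc k)) n (ℕ.s≤s n≤k)))))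
    ... | no n≰k with ℕₚ.m≤n⇒∃[o]m+o≡n (ℕₚ.≰⇒> n≰k)
    ... | j , ≡.refl = ℤ/7.trans (≡⇒≅ (≡.cong +_ (op-+ j k)))
      (ℤ/7.+-congˡ {+ op (suc k ℕ.+ j) k} (ℤ/7.sym (X^-⊛-+ (suc k) (O k + O (suc k)) j)))

  -- The truncations of φ(-q) = Σ (-1)ˣ q^(x²), with (-1)ˣ = (-1)^(x²).
  θ : ℕ → Series
  θ n = ∑ (range n) λ x → (- X) ^ square x

  ∑-map-upTo-suc : ∀ {A : Set} (g : ℕ → A) n (f : A → Series) → ∑ (map g (upTo (suc n))) f ≈ ∑ (map g (upTo n)) f + f (g n)
  ∑-map-upTo-suc g n f = begin
    ∑ (map g (upTo (suc n))) f       ≡⟨ ≡.cong (λ l → ∑ (map g l) f) (≡.sym (Listₚ.upTo-∷ʳ n)) ⟩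
    ∑ (map g (upTo n ∷ʳ n)) f        ≈⟨ ∑-map g (upTo n ∷ʳ n) f ⟩
    ∑ (upTo n ∷ʳ n) (f ∘ g)          ≈⟨ ∑-++ (upTo n) (n ∷ []) (f ∘ g) ⟩
    ∑ (upTo n) (f ∘ g) + (f (g n) + 0#) ≈⟨ +-cong (sym (∑-map g (upTo n) f)) (+-identityʳ _) ⟩
    ∑ (map g (upTo n)) f + f (g n) ∎
    where open SetoidReasoning setoid

  θ-zero : θ 0 ≈ 1#
  θ-zero = +-identityʳ 1#

  θ-suc : ∀ n → θ (suc n) ≈ θ n + ((- X) ^ (suc n ℕ.* suc n) + (- X) ^ (suc n ℕ.* suc n))
  θ-suc n = begin
    θ (suc n) ≈⟨ ∑-++ (map +_ (upTo (suc (suc n)))) (map -[1+_] (upTo (suc n))) z ⟩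
    ∑ (map +_ (upTo (suc (suc n)))) z + ∑ (map -[1+_] (upTo (suc n))) z
      ≈⟨ +-cong (∑-map-upTo-suc +_ (suc n) z) (∑-map-upTo-suc -[1+_] n z) ⟩
    (p + w) + (m + w) ≈⟨ solve 3 (λ p m w → (p :+ w) :+ (m :+ w) := (p :+ m) :+ (w :+ w)) refl p m w ⟩
    (p + m) + (w + w) ≈⟨ +-congʳ (sym (∑-++ (map +_ (upTo (suc n))) (map -[1+_] (upTo n)) z)) ⟩
    θ n + (w + w) ∎
    where
    open SetoidReasoning setoid
    z : ℤ → Series
    z x = (- X) ^ square x
    w = (- X) ^ (suc n ℕ.* suc n)
    p = ∑ (map +_ (upTo (suc n))) z
    m = ∑ (map -[1+_] (upTo n)) z

  -- The limit of the truncations, taken along the diagonal: terms with |x| > n have degree x² > n,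
  -- so `θ n` already has its final coefficient in degree n.
  φ : Series
  coeff φ n = coeff (θ n) n

  coeff-θ : ∀ {k n} → n ℕ.≤ k → coeff (θ k) n ≅ coeff φ n
  coeff-θ n≤k = go (ℕₚ.≤⇒≤′ n≤k)
    where
    go : ∀ {k n} → n ℕ.≤′ k → coeff (θ k) n ≅ coeff φ n
    go ℕ.≤′-refl = ℤ/7.refl
    go {suc k} {n} (ℕ.≤′-step n≤k) = ℤ/7.trans (at (θ-suc k) n) (ℤ/7.trans
      (ℤ/7.+-congˡ {coeff (θ k) n} (ℤ/7.+-cong vanish vanish)) (ℤ/7.trans (ℤ/7.+-identityʳ _) (go n≤k)))
      where
      vanish : coeff ((- X) ^ (suc k ℕ.* suc k)) n ≅ + 0
      vanish = coeff-[⊖X]^-≢ (suc k ℕ.* suc k) n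
        (ℕₚ.>⇒≢ (ℕₚ.<-≤-trans (ℕ.s≤s (ℕₚ.≤′⇒≤ n≤k)) (ℕₚ.m≤m*n (suc k) (suc k))))

  -- In degree n the factors agree with `θ n` and `O n`, to which the finite identity applies in its
  -- top degree m = n.
  φ*P≈1 : φ * P ≈ 1#
  φ*P≈1 = pointwise λ n → ℤ/7.trans
    (⊛-cong-≤ {f′ = θ n} {g′ = O n} n (λ i i≤n → ℤ/7.sym (coeff-θ i≤n))
      (λ i i≤n → ≡⇒≅ (≡.cong +_ (≡.sym (op≡overpartitions i≤n)))))
    (gauss O O-zero O-suc θ θ-zero θ-suc n n ℕₚ.≤-refl)

  -- Negative integers never occur as norms; they are sent to the junk value 0.
  monomial : ℤ → Series
  monomial (+ n)      = (- X) ^ n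
  monomial (-[1+ _ ]) = 0#

  sign : ℕ → ℤ
  sign n = (ℤ.- (+ 1)) ℤ.^ n

  -- All terms of degree n carry the same sign (-1)ⁿ, so a coefficient is a signed count. This is
  -- the passage from powers of φ to r₃ and r₄.
  coeff-∑-monomial : ∀ {A : Set} (xs : List A) (w : A → ℤ) n →
    coeff (∑ xs (monomial ∘ w)) n ≅ sign n ℤ.* + length (filter (λ x → w x ℤ.≟ + n) xs)
  coeff-∑-monomial []       w n = ≡⇒≅ (≡.sym (ℤₚ.*-zeroʳ (sign n)))
  coeff-∑-monomial (x ∷ xs) w n with w x ℤ.≟ + n
  ... | yes eq = ℤ/7.trans (ℤ/7.+-cong hit (coeff-∑-monomial xs w n)) (≡⇒≅ (≡.trans
          (≡.cong (ℤ._+ sign n ℤ.* count) (≡.sym (ℤₚ.*-identityʳ (sign n)))) (≡.sym (ℤₚ.*-distribˡ-+ (sign n) (+ 1) count))))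
    where
    count = + length (filter (λ x → w x ℤ.≟ + n) xs)
    hit : coeff (monomial (w x)) n ≅ sign n
    hit = ≡.subst (λ v → coeff (monomial v) n ≅ sign n) (≡.sym eq)
      (ℤ/7.trans (coeff-[⊖X]^-≡ n) (≡⇒≅ (ℤ/7-^ (ℤ.- (+ 1)) n)))
  ... | no neq = ℤ/7.trans (ℤ/7.+-cong (miss (w x) neq) (coeff-∑-monomial xs w n)) (ℤ/7.+-identityˡ _)
    where
    miss : ∀ v → v ≢ + n → coeff (monomial v) n ≅ + 0
    miss (+ k)      v≢n = coeff-[⊖X]^-≢ k n (λ k≡n → v≢n (≡.cong (+_) k≡n))
    miss (-[1+ k ]) v≢n = ℤ/7.refl

  -- In degree n, φ may be replaced by `θ n`; expanding its cube over `range n` reproduces the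
  -- nested list in the definition of `r₃`.
  coeff-φ³ : ∀ n → coeff (φ * φ * φ) n ≅ sign n ℤ.* + r₃ n
  coeff-φ³ n = ℤ/7.trans (⊛-cong-≤ {f′ = θ n * θ n} {g′ = θ n} n
      (λ i i≤n → ⊛-cong-≤ i (λ j j≤i → ℤ/7.sym (coeff-θ (ℕₚ.≤-trans j≤i i≤n)))
                             (λ j j≤i → ℤ/7.sym (coeff-θ (ℕₚ.≤-trans j≤i i≤n))))
      (λ i i≤n → ℤ/7.sym (coeff-θ i≤n)))
    (ℤ/7.trans (at (sym expand) n) (coeff-∑-monomial (concatMap plane R) (λ t → t) n))
    where
    open SetoidReasoning setoid
    R = range n
    z : ℤ → Series
    z x = (- X) ^ square x
    row : ℤ → ℤ → List ℤ
    row x y = map (λ z → x ℤ.* x ℤ.+ y ℤ.* y ℤ.+ z ℤ.* z) R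
    plane : ℤ → List ℤ
    plane x = concatMap (row x) R

    factor : ∀ x y t → monomial (x ℤ.* x ℤ.+ y ℤ.* y ℤ.+ t ℤ.* t) ≈ z x * z y * z t
    factor x y t = begin
      monomial (x ℤ.* x ℤ.+ y ℤ.* y ℤ.+ t ℤ.* t)
        ≡⟨ ≡.cong monomial (≡.cong₂ ℤ._+_ (≡.cong₂ ℤ._+_ (a*a≡+square x) (a*a≡+square y)) (a*a≡+square t)) ⟩
      (- X) ^ (square x ℕ.+ square y ℕ.+ square t) ≈⟨ ^-homo-* (- X) (square x ℕ.+ square y) (square t) ⟩
      (- X) ^ (square x ℕ.+ square y) * z t ≈⟨ *-congʳ (^-homo-* (- X) (square x) (square y)) ⟩
      z x * z y * z t ∎

    ∑-row : ∀ x y → ∑ (row x y) monomial ≈ z x * z y * θ n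
    ∑-row x y = trans (∑-map (λ z → x ℤ.* x ℤ.+ y ℤ.* y ℤ.+ z ℤ.* z) R monomial)
      (trans (∑-cong R (factor x y)) (sym (∑-*ˡ R z (z x * z y))))

    expand : ∑ (concatMap plane R) monomial ≈ θ n * θ n * θ n
    expand = begin
      ∑ (concatMap plane R) monomial ≈⟨ ∑-concatMap plane R monomial ⟩
      ∑ R (λ x → ∑ (plane x) monomial)
        ≈⟨ ∑-cong R (λ x → trans (∑-concatMap (row x) R monomial) (∑-cong R (∑-row x))) ⟩
      ∑ R (λ x → ∑ R (λ y → z x * z y * θ n))
        ≈⟨ ∑-cong R (λ x → trans (sym (∑-*ʳ R (λ y → z x * z y) (θ n))) (*-congʳ (sym (∑-*ˡ R z (z x))))) ⟩
      ∑ R (λ x → z x * θ n * θ n)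
        ≈⟨ sym (trans (*-congʳ (∑-*ʳ R z (θ n))) (∑-*ʳ R (λ x → z x * θ n) (θ n))) ⟩
      θ n * θ n * θ n ∎

  coeff-φ⁴ : ∀ n → coeff (φ * (φ * (φ * φ))) n ≅ sign n ℤ.* + length (ofNorm n)
  coeff-φ⁴ n = ℤ/7.trans (agree n ℕₚ.≤-refl) (ℤ/7.trans (at (sym expand) n) (coeff-∑-monomial (box n) norm n))
    where
    open SetoidReasoning setoid
    R = range n
    z : ℤ → Series
    z x = (- X) ^ square x

    mul : ∀ {f g f′ g′} → (∀ i → i ℕ.≤ n → coeff f i ≅ coeff f′ i) → (∀ i → i ℕ.≤ n → coeff g i ≅ coeff g′ i) →
          ∀ i → i ℕ.≤ n → coeff (f * g) i ≅ coeff (f′ * g′) i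
    mul p q i i≤n = ⊛-cong-≤ i (λ j j≤i → p j (ℕₚ.≤-trans j≤i i≤n)) (λ j j≤i → q j (ℕₚ.≤-trans j≤i i≤n))

    φθ : ∀ i → i ℕ.≤ n → coeff φ i ≅ coeff (θ n) i
    φθ i i≤n = ℤ/7.sym (coeff-θ i≤n)

    agree : ∀ i → i ℕ.≤ n → coeff (φ * (φ * (φ * φ))) i ≅ coeff (θ n * (θ n * (θ n * θ n))) i
    agree = mul φθ (mul φθ (mul φθ φθ))

    factor : ∀ q → monomial (norm q) ≈ (λ (a , b , c , d) → z a * (z b * (z c * z d))) q
    factor (a , b , c , d) = begin
      monomial (norm (a , b , c , d)) ≡⟨ ≡.cong monomial (norm≡+squares a b c d) ⟩
      (- X) ^ (square a ℕ.+ square b ℕ.+ square c ℕ.+ square d)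
        ≈⟨ ^-homo-* (- X) (square a ℕ.+ square b ℕ.+ square c) (square d) ⟩
      (- X) ^ (square a ℕ.+ square b ℕ.+ square c) * z d
        ≈⟨ *-congʳ (^-homo-* (- X) (square a ℕ.+ square b) (square c)) ⟩
      (- X) ^ (square a ℕ.+ square b) * z c * z d
        ≈⟨ *-congʳ (*-congʳ (^-homo-* (- X) (square a) (square b))) ⟩
      z a * z b * z c * z d
        ≈⟨ solve 4 (λ a b c d → a :* b :* c :* d := a :* (b :* (c :* d))) refl (z a) (z b) (z c) (z d) ⟩
      z a * (z b * (z c * z d)) ∎

    expand : ∑ (box n) (monomial ∘ norm) ≈ θ n * (θ n * (θ n * θ n))
    expand = trans (∑-cong (box n) factor)
      (trans (∑-cartesianProduct R (cartesianProduct R (cartesianProduct R R)) z (λ (b , c , d) → z b * (z c * z d))) (*-congˡ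
      (trans (∑-cartesianProduct R (cartesianProduct R R) z (λ (c , d) → z c * z d)) (*-congˡ (∑-cartesianProduct R R z z)))))

  -- (-1)⁷ evaluates to -1, so this is the law for iterated powers read backwards.
  sign-7* : ∀ n → sign (7 ℕ.* n) ≡ sign n
  sign-7* n = ≡.sym (ℤₚ.^-*-assoc (ℤ.- (+ 1)) 7 n)

  multisect-φ⁴ : multisect 7 (φ * (φ * (φ * φ))) ≈ φ * (φ * (φ * φ))
  multisect-φ⁴ = pointwise λ n → ℤ/7.trans (coeff-φ⁴ (7 ℕ.* n)) (ℤ/7.trans
    (ℤ/7.*-cong (≡⇒≅ (sign-7* n)) (length-ofNorm-7* n)) (ℤ/7.sym (coeff-φ⁴ n)))

  p̄₃-7* : ∀ n → + p̄₃ (7 ℕ.* n) ≅ sign n ℤ.* + r₃ n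
  p̄₃-7* n = ℤ/7.trans (ℤ/7.sym (coeff-P*P*P (7 ℕ.* n))) (ℤ/7.trans (at lift (7 ℕ.* n))
    (ℤ/7.trans (at (multisect-^7-* (congruent (Signed.divides (+ 1) ≡.refl)) fermat P (φ * (φ * (φ * φ)))) n)
    (ℤ/7.trans (at (trans (*-congˡ multisect-φ⁴) cancel) n) (coeff-φ³ n))))
    where
    open SetoidReasoning setoid
    lift : P * (P * P) ≈ P ^ 7 * (φ * (φ * (φ * φ)))
    lift = begin
      P * (P * P) ≈⟨ sym (*-identityʳ _) ⟩
      P * (P * P) * 1# ≈⟨ *-congˡ (sym (trans (^-congˡ 4 φ*P≈1)
           (trans (*-identityˡ _) (trans (*-identityˡ _) (trans (*-identityˡ _) (*-identityˡ _)))))) ⟩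
      P * (P * P) * (φ * P) ^ 4
        ≈⟨ solve 2 (λ p f → p :* (p :* p) :* (f :* p) :^ 4 := p :^ 7 :* (f :* (f :* (f :* f)))) refl P φ ⟩
      P ^ 7 * (φ * (φ * (φ * φ))) ∎
    cancel : P * (φ * (φ * (φ * φ))) ≈ φ * φ * φ
    cancel = begin
      P * (φ * (φ * (φ * φ)))
        ≈⟨ solve 2 (λ p f → p :* (f :* (f :* (f :* f))) := (f :* p) :* (f :* f :* f)) refl P φ ⟩
      (φ * P) * (φ * φ * φ) ≈⟨ trans (*-congʳ φ*P≈1) (*-identityˡ _) ⟩
      φ * φ * φ ∎

open import Data.Nat using (ℕ; _*_; _≥_)
open import Data.Integer using (ℤ; +_; -_; _^_)
open import Data.Integer.Divisibility using (_∣_)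
import Data.Integer as ℤ
import Data.Integer.Divisibility.Signed as Signed

theorem4p1 : (n : ℕ) → n ≥ 1 →
    (+ 7) ∣ ((+ p̄₃ (7 * n)) ℤ.- ((- (+ 1)) ^ n) ℤ.* (+ r₃ n))
theorem4p1 n _ = Signed.∣⇒∣ᵤ (IntegersMod.divisible (OverpartitionTriples.p̄₃-7* n))
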